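{- No graph containing (as a subgraph) the spider on three legs of length three can be drawn as a great-circle thrackle.
   Context: Graphs are finite, simple and undirected. A thrackle is a drawing of a graph in which no curve (edge) crosses itself and every pair of curves (edges) intersects at exactly one point (so two edges with a common endpoint meet only at that endpoint, and two edges with no common endpoint meet at exactly one point). A great-circle thrackle is a thrackle drawn on the unit sphere $S^2$ whose vertices are represented as (distinct) points of the sphere and whose edges are represented by arcs of great circles joining their endpoints (an arc may be shorter or longer than $\pi$). Great-circle thrackles are assumed to be in general position: no three vertices lie on the same great circle and no two vertices are antipodal. A spider is a tree in which exactly one vertex $v_0$ has degree at least $3$ and all other vertices have degree at most $2$. The degree of $v_0$ is the number of legs of the spider; the length of a leg is the length (number of edges) of the path beginning at a degree-$1$ vertex and terminating at $v_0$. Thus the spider on three legs of length three has $10$ vertices: $z$ and $v_i, w_i, u_i$ for $i=1,2,3$, with edges $zv_1, v_1v_2, v_2v_3, zw_1, w_1w_2, w_2w_3, zu_1, u_1u_2, u_2u_3$. -}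

module Defs where

open import Level using (0ℓ)
open import Data.Fin using (Fin; zero; suc; inject₁; combine; remQuot)
open import Data.Fin.Properties using (combine-remQuot; remQuot-combine)
open import Data.Fin.Patterns using (0F; 1F; 2F)
open import Data.Nat as ℕ using (ℕ; _⊔_)
import Data.Nat.Properties as ℕₚ
open import Data.Product using (∃-syntax; _×_; _,_; proj₁; proj₂)
open import Data.Sum using (_⊎_)
open import Data.Rational as ℚ using (ℚ; 0ℚ; 1ℚ; ½; ∣_∣)
import Data.Rational.Properties as ℚₚ
open import Data.Rational.Solver using (module +-*-Solver)
open import Data.Vec.Functional using (Vector)
open import Function.Bundles using (_↔_; mk↔ₛ′)
open import Function.Definitions using (Injective)
open import Relation.Binary.Core using (Rel; _Preserves_⟶_)
open import Relation.Binary.Construct.Closure.Symmetric using (SymClosure; fwd; bwd; symmetric)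
open import Relation.Binary.Definitions using (Symmetric)
open import Relation.Binary.PropositionalEquality
open import Relation.Nullary using (¬_)

------------------------------------------------------------------------
-- Real numbers, as Cauchy sequences of rationals.  Operations are
-- pointwise; equality of reals is the setoid equality _≈_.

IsCauchy : (ℕ → ℚ) → Set
IsCauchy x = ∀ ε → 0ℚ ℚ.< ε →
  ∃[ N ] (∀ m n → N ℕ.≤ m → N ℕ.≤ n → ∣ x m ℚ.- x n ∣ ℚ.< ε)

record ℝ : Set where
  constructor mkℝ
  field
    seq    : ℕ → ℚ
    cauchy : IsCauchy seq

open ℝ public

open ℚₚ.≤-Reasoning

-- Abstract so that the Cauchy proofs inside real expressions never unfold.
abstract
  half-pos : ∀ {ε} → 0ℚ ℚ.< ε → 0ℚ ℚ.< ½ ℚ.* ε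
  half-pos {ε} 0<ε = begin-strict
    0ℚ          ≡⟨ ℚₚ.*-zeroʳ ½ ⟨
    ½ ℚ.* 0ℚ    <⟨ ℚₚ.*-monoʳ-<-pos ½ 0<ε ⟩
    ½ ℚ.* ε     ∎

  halves : ∀ ε → ½ ℚ.* ε ℚ.+ ½ ℚ.* ε ≡ ε
  halves ε = trans (sym (ℚₚ.*-distribʳ-+ ε ½ ½)) (ℚₚ.*-identityˡ ε)

  shrink : ∀ {B ε} → 0ℚ ℚ.< B → 0ℚ ℚ.< ε → ∃[ δ ] (0ℚ ℚ.< δ × B ℚ.* δ ≡ ε)
  shrink {B} {ε} 0<B 0<ε = B⁻¹ ℚ.* ε , 0<δ , eq
    where
    instance
      B-pos : ℚ.Positive B
      B-pos = ℚ.positive 0<B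
      B-nz : ℚ.NonZero B
      B-nz = ℚₚ.pos⇒nonZero B
    B⁻¹ : ℚ
    B⁻¹ = ℚ.1/ B
    instance
      B⁻¹-pos : ℚ.Positive B⁻¹
      B⁻¹-pos = ℚₚ.1/pos⇒pos B
    0<δ : 0ℚ ℚ.< B⁻¹ ℚ.* ε
    0<δ = begin-strict
      0ℚ            ≡⟨ ℚₚ.*-zeroʳ B⁻¹ ⟨
      B⁻¹ ℚ.* 0ℚ    <⟨ ℚₚ.*-monoʳ-<-pos B⁻¹ 0<ε ⟩
      B⁻¹ ℚ.* ε     ∎
    eq : B ℚ.* (B⁻¹ ℚ.* ε) ≡ ε
    eq = trans (sym (ℚₚ.*-assoc B B⁻¹ ε))
           (trans (cong (ℚ._* ε) (ℚₚ.*-inverseʳ B)) (ℚₚ.*-identityˡ ε))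

  bounded : ∀ {x} → IsCauchy x →
            ∃[ B ] (0ℚ ℚ.< B × ∃[ N ] (∀ n → N ℕ.≤ n → ∣ x n ∣ ℚ.≤ B))
  bounded {x} cx with cx 1ℚ (ℚₚ.positive⁻¹ 1ℚ)
  ... | N , close = ∣ x N ∣ ℚ.+ 1ℚ , 0<B , N , below
    where
    0<B : 0ℚ ℚ.< ∣ x N ∣ ℚ.+ 1ℚ
    0<B = ℚₚ.+-mono-≤-< (ℚₚ.0≤∣p∣ (x N)) (ℚₚ.positive⁻¹ 1ℚ)
    split : ∀ p q → p ≡ q ℚ.+ (p ℚ.- q)
    split = solve 2 (λ p q → p := q :+ (p :- q)) refl
      where open +-*-Solver
    below : ∀ n → N ℕ.≤ n → ∣ x n ∣ ℚ.≤ ∣ x N ∣ ℚ.+ 1ℚ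
    below n N≤n = begin
      ∣ x n ∣                          ≡⟨ cong ∣_∣ (split (x n) (x N)) ⟩
      ∣ x N ℚ.+ (x n ℚ.- x N) ∣        ≤⟨ ℚₚ.∣p+q∣≤∣p∣+∣q∣ (x N) (x n ℚ.- x N) ⟩
      ∣ x N ∣ ℚ.+ ∣ x n ℚ.- x N ∣      ≤⟨ ℚₚ.+-monoʳ-≤ ∣ x N ∣ (ℚₚ.<⇒≤ (close n N N≤n ℕₚ.≤-refl)) ⟩
      ∣ x N ∣ ℚ.+ 1ℚ                   ∎

  *-bound : ∀ {a B d δ} → 0ℚ ℚ.< B → ∣ a ∣ ℚ.≤ B → ∣ d ∣ ℚ.< δ → ∣ a ℚ.* d ∣ ℚ.< B ℚ.* δ
  *-bound {a} {B} {d} {δ} 0<B a≤B d<δ = begin-strict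
    ∣ a ℚ.* d ∣        ≡⟨ ℚₚ.∣p*q∣≡∣p∣*∣q∣ a d ⟩
    ∣ a ∣ ℚ.* ∣ d ∣    ≤⟨ ℚₚ.*-monoʳ-≤-nonNeg ∣ d ∣ {{ℚₚ.∣-∣-nonNeg d}} a≤B ⟩
    B ℚ.* ∣ d ∣        <⟨ ℚₚ.*-monoʳ-<-pos B {{ℚ.positive 0<B}} d<δ ⟩
    B ℚ.* δ            ∎

  const-cauchy : ∀ q → IsCauchy (λ _ → q)
  const-cauchy q ε 0<ε = 0 , λ _ _ _ _ → subst (λ t → ∣ t ∣ ℚ.< ε) (sym (ℚₚ.+-inverseʳ q)) 0<ε

  neg-cauchy : ∀ x → IsCauchy x → IsCauchy (λ n → ℚ.- x n)
  neg-cauchy x cx ε 0<ε with cx ε 0<ε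
  ... | N , close = N , λ m n N≤m N≤n →
    subst (λ t → ∣ t ∣ ℚ.< ε) (rearrange (x m) (x n)) (close n m N≤n N≤m)
    where
    rearrange : ∀ p q → q ℚ.- p ≡ ℚ.- p ℚ.- (ℚ.- q)
    rearrange = solve 2 (λ p q → q :- p := :- p :- (:- q)) refl
      where open +-*-Solver

  +-cauchy : ∀ x y → IsCauchy x → IsCauchy y → IsCauchy (λ n → x n ℚ.+ y n)
  +-cauchy x y cx cy ε 0<ε with cx (½ ℚ.* ε) (half-pos 0<ε) | cy (½ ℚ.* ε) (half-pos 0<ε)
  ... | N₁ , close₁ | N₂ , close₂ = N₁ ⊔ N₂ , λ m n N≤m N≤n → begin-strict
    ∣ (x m ℚ.+ y m) ℚ.- (x n ℚ.+ y n) ∣      ≡⟨ cong ∣_∣ (rearrange (x m) (y m) (x n) (y n)) ⟩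
    ∣ (x m ℚ.- x n) ℚ.+ (y m ℚ.- y n) ∣      ≤⟨ ℚₚ.∣p+q∣≤∣p∣+∣q∣ (x m ℚ.- x n) (y m ℚ.- y n) ⟩
    ∣ x m ℚ.- x n ∣ ℚ.+ ∣ y m ℚ.- y n ∣      <⟨ ℚₚ.+-mono-<
      (close₁ m n (ℕₚ.m⊔n≤o⇒m≤o N₁ N₂ N≤m) (ℕₚ.m⊔n≤o⇒m≤o N₁ N₂ N≤n))
      (close₂ m n (ℕₚ.m⊔n≤o⇒n≤o N₁ N₂ N≤m) (ℕₚ.m⊔n≤o⇒n≤o N₁ N₂ N≤n)) ⟩
    ½ ℚ.* ε ℚ.+ ½ ℚ.* ε                      ≡⟨ halves ε ⟩
    ε                                        ∎
    where
    rearrange : ∀ a b c d → (a ℚ.+ b) ℚ.- (c ℚ.+ d) ≡ (a ℚ.- c) ℚ.+ (b ℚ.- d)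
    rearrange = solve 4 (λ a b c d → (a :+ b) :- (c :+ d) := (a :- c) :+ (b :- d)) refl
      where open +-*-Solver

  *-rearrange : ∀ a b c d → a ℚ.* b ℚ.- c ℚ.* d ≡ a ℚ.* (b ℚ.- d) ℚ.+ d ℚ.* (a ℚ.- c)
  *-rearrange = solve 4 (λ a b c d → a :* b :- c :* d := a :* (b :- d) :+ d :* (a :- c)) refl
    where open +-*-Solver

  *-close : ∀ {A B α β} a b c d → 0ℚ ℚ.< A → 0ℚ ℚ.< B → ∣ a ∣ ℚ.≤ A → ∣ d ∣ ℚ.≤ B →
            ∣ a ℚ.- c ∣ ℚ.< β → ∣ b ℚ.- d ∣ ℚ.< α →
            ∣ a ℚ.* b ℚ.- c ℚ.* d ∣ ℚ.< A ℚ.* α ℚ.+ B ℚ.* β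
  *-close {A} {B} {α} {β} a b c d 0<A 0<B a≤A d≤B a-c<β b-d<α = begin-strict
    ∣ a ℚ.* b ℚ.- c ℚ.* d ∣
      ≡⟨ cong ∣_∣ (*-rearrange a b c d) ⟩
    ∣ a ℚ.* (b ℚ.- d) ℚ.+ d ℚ.* (a ℚ.- c) ∣
      ≤⟨ ℚₚ.∣p+q∣≤∣p∣+∣q∣ (a ℚ.* (b ℚ.- d)) (d ℚ.* (a ℚ.- c)) ⟩
    ∣ a ℚ.* (b ℚ.- d) ∣ ℚ.+ ∣ d ℚ.* (a ℚ.- c) ∣
      <⟨ ℚₚ.+-mono-< (*-bound {a} {A} {b ℚ.- d} {α} 0<A a≤A b-d<α)
                     (*-bound {d} {B} {a ℚ.- c} {β} 0<B d≤B a-c<β) ⟩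
    A ℚ.* α ℚ.+ B ℚ.* β ∎

  *-cauchy : ∀ x y → IsCauchy x → IsCauchy y → IsCauchy (λ n → x n ℚ.* y n)
  *-cauchy x y cx cy ε 0<ε =
    let A , 0<A , Nx , x≤A = bounded cx
        B , 0<B , Ny , y≤B = bounded cy
        α , 0<α , Aα≡ = shrink 0<A (half-pos 0<ε)
        β , 0<β , Bβ≡ = shrink 0<B (half-pos 0<ε)
        Mx , closeˣ = cx β 0<β
        My , closeʸ = cy α 0<α
    in finish A B α β Nx Ny Mx My 0<A 0<B x≤A y≤B closeˣ closeʸ
         (trans (cong₂ ℚ._+_ Aα≡ Bβ≡) (halves ε))
    where
    finish : ∀ A B α β Nx Ny Mx My → 0ℚ ℚ.< A → 0ℚ ℚ.< B →
      (∀ n → Nx ℕ.≤ n → ∣ x n ∣ ℚ.≤ A) → (∀ n → Ny ℕ.≤ n → ∣ y n ∣ ℚ.≤ B) →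
      (∀ m n → Mx ℕ.≤ m → Mx ℕ.≤ n → ∣ x m ℚ.- x n ∣ ℚ.< β) →
      (∀ m n → My ℕ.≤ m → My ℕ.≤ n → ∣ y m ℚ.- y n ∣ ℚ.< α) →
      A ℚ.* α ℚ.+ B ℚ.* β ≡ ε →
      ∃[ N ] (∀ m n → N ℕ.≤ m → N ℕ.≤ n → ∣ x m ℚ.* y m ℚ.- x n ℚ.* y n ∣ ℚ.< ε)
    finish A B α β Nx Ny Mx My 0<A 0<B x≤A y≤B closeˣ closeʸ eq =
      (Nx ⊔ Ny) ⊔ (Mx ⊔ My) , λ m n N≤m N≤n →
        subst (∣ x m ℚ.* y m ℚ.- x n ℚ.* y n ∣ ℚ.<_) eq
          (*-close (x m) (y m) (x n) (y n) 0<A 0<B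
            (x≤A m (Nx≤ N≤m)) (y≤B n (Ny≤ N≤n))
            (closeˣ m n (Mx≤ N≤m) (Mx≤ N≤n)) (closeʸ m n (My≤ N≤m) (My≤ N≤n)))
      where
      Nx≤ : ∀ {k} → (Nx ⊔ Ny) ⊔ (Mx ⊔ My) ℕ.≤ k → Nx ℕ.≤ k
      Nx≤ p = ℕₚ.m⊔n≤o⇒m≤o Nx Ny (ℕₚ.m⊔n≤o⇒m≤o (Nx ⊔ Ny) (Mx ⊔ My) p)
      Ny≤ : ∀ {k} → (Nx ⊔ Ny) ⊔ (Mx ⊔ My) ℕ.≤ k → Ny ℕ.≤ k
      Ny≤ p = ℕₚ.m⊔n≤o⇒n≤o Nx Ny (ℕₚ.m⊔n≤o⇒m≤o (Nx ⊔ Ny) (Mx ⊔ My) p)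
      Mx≤ : ∀ {k} → (Nx ⊔ Ny) ⊔ (Mx ⊔ My) ℕ.≤ k → Mx ℕ.≤ k
      Mx≤ p = ℕₚ.m⊔n≤o⇒m≤o Mx My (ℕₚ.m⊔n≤o⇒n≤o (Nx ⊔ Ny) (Mx ⊔ My) p)
      My≤ : ∀ {k} → (Nx ⊔ Ny) ⊔ (Mx ⊔ My) ℕ.≤ k → My ℕ.≤ k
      My≤ p = ℕₚ.m⊔n≤o⇒n≤o Mx My (ℕₚ.m⊔n≤o⇒n≤o (Nx ⊔ Ny) (Mx ⊔ My) p)

infix  4 _≈_ _<_ _≤_
infix  8 -_
infixl 7 _*_
infixl 6 _+_

-- Records rather than plain definitions, so that x and y can be inferred.
record _≈_ (x y : ℝ) : Set where
  constructor mk≈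
  field
    eventually-close : ∀ ε → 0ℚ ℚ.< ε →
      ∃[ N ] (∀ n → N ℕ.≤ n → ∣ seq x n ℚ.- seq y n ∣ ℚ.< ε)

record _<_ (x y : ℝ) : Set where
  constructor mk<
  field
    eventually-below :
      ∃[ ε ] (0ℚ ℚ.< ε × ∃[ N ] (∀ n → N ℕ.≤ n → seq x n ℚ.+ ε ℚ.≤ seq y n))

open _≈_ public
open _<_ public

_≤_ : Rel ℝ 0ℓ
x ≤ y = ¬ (y < x)

fromℚ : ℚ → ℝ
fromℚ q = mkℝ (λ _ → q) (const-cauchy q)

0ℝ 1ℝ : ℝ
0ℝ = fromℚ 0ℚ
1ℝ = fromℚ 1ℚ

_+_ : ℝ → ℝ → ℝ
x + y = mkℝ (λ n → seq x n ℚ.+ seq y n) (+-cauchy (seq x) (seq y) (cauchy x) (cauchy y))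

_*_ : ℝ → ℝ → ℝ
x * y = mkℝ (λ n → seq x n ℚ.* seq y n) (*-cauchy (seq x) (seq y) (cauchy x) (cauchy y))

-_ : ℝ → ℝ
- x = mkℝ (λ n → ℚ.- seq x n) (neg-cauchy (seq x) (cauchy x))

------------------------------------------------------------------------
-- The unit sphere

ℝ³ : Set
ℝ³ = Vector ℝ 3

infix  4 _≈³_
infix  8 -³_
infixl 7 _*³_ _∙_
infixl 6 _+³_

_≈³_ : Rel ℝ³ 0ℓ
u ≈³ v = ∀ i → u i ≈ v i

0³ : ℝ³
0³ _ = 0ℝ

_+³_ : ℝ³ → ℝ³ → ℝ³
(u +³ v) i = u i + v i

-³_ : ℝ³ → ℝ³
(-³ u) i = - u i

_*³_ : ℝ → ℝ³ → ℝ³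
(a *³ u) i = a * u i

_∙_ : ℝ³ → ℝ³ → ℝ
u ∙ v = u 0F * v 0F + u 1F * v 1F + u 2F * v 2F

record S² : Set where
  field
    vec  : ℝ³
    unit : vec ∙ vec ≈ 1ℝ

open S² public

_≈ˢ_ : Rel S² 0ℓ
x ≈ˢ y = vec x ≈³ vec y

Antipodal : Rel S² 0ℓ
Antipodal x y = vec x ≈³ -³ vec y

-- A great circle is cut out by a plane through the centre; the plane is
-- given by a nonzero, not necessarily unit, normal vector.
record GreatCircle : Set where
  field
    normal  : ℝ³
    nonzero : ¬ (normal ≈³ 0³)

open GreatCircle public

OnCircle : GreatCircle → S² → Set
OnCircle C x = normal C ∙ vec x ≈ 0ℝ

-- Two points that are neither equal nor antipodal lie on a unique great
-- circle, which they divide into one arc shorter than π and one longer.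
data ArcKind : Set where
  short long : ArcKind

-- Writing the points of that circle as a p + b q, the short closed arc
-- is the part with a , b ≥ 0, and the long closed arc is the complement
-- of the open short arc a , b > 0.
OnArc : ArcKind → S² → S² → S² → Set
OnArc short p q x = ∃[ a ] ∃[ b ]
  (vec x ≈³ a *³ vec p +³ b *³ vec q × 0ℝ ≤ a × 0ℝ ≤ b)
OnArc long  p q x = ∃[ a ] ∃[ b ]
  (vec x ≈³ a *³ vec p +³ b *³ vec q × ¬ (0ℝ < a × 0ℝ < b))

------------------------------------------------------------------------
-- Graphs

record Graph : Set₁ where
  field
    Vertex : Set
    finite : ∃[ n ] (Vertex ↔ Fin n)
    Adj    : Rel Vertex 0ℓ
    sym-Adj    : Symmetric Adj
    irrefl-Adj : ∀ {v} → ¬ Adj v v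

open Graph public

-- Containment as a not necessarily induced subgraph.
_Contains_ : Graph → Graph → Set
G Contains H = ∃[ f ]
  (Injective _≡_ _≡_ f × f Preserves Adj H ⟶ Adj G)

data SpiderVertex : Set where
  centre : SpiderVertex
  leg    : (i j : Fin 3) → SpiderVertex

-- leg i j is the vertex of leg i at distance j + 1 from the centre.
data SpiderEdge : Rel SpiderVertex 0ℓ where
  root : ∀ i → SpiderEdge centre (leg i zero)
  step : ∀ i (j : Fin 2) → SpiderEdge (leg i (inject₁ j)) (leg i (suc j))

spider₃₃₃ : Graph
spider₃₃₃ = record
  { Vertex     = SpiderVertex
  ; finite     = 10 , mk↔ₛ′ to from to-from from-to
  ; Adj        = SymClosure SpiderEdge
  ; sym-Adj    = symmetric SpiderEdge
  ; irrefl-Adj = λ { (fwd e) → no-loop e ; (bwd e) → no-loop e }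
  }
  where
  no-loop : ∀ {v} → ¬ SpiderEdge v v
  no-loop {leg i zero} ()
  no-loop {leg i (suc zero)} ()
  no-loop {leg i (suc (suc zero))} ()

  to : SpiderVertex → Fin 10
  to centre = zero
  to (leg i j) = suc (combine i j)

  from : Fin 10 → SpiderVertex
  from zero    = centre
  from (suc k) = leg (proj₁ (remQuot {3} 3 k)) (proj₂ (remQuot {3} 3 k))

  to-from : ∀ k → to (from k) ≡ k
  to-from zero    = refl
  to-from (suc k) = cong suc (combine-remQuot {3} 3 k)

  from-to : ∀ v → from (to v) ≡ v
  from-to centre    = refl
  from-to (leg i j) = cong (λ p → leg (proj₁ p) (proj₂ p)) (remQuot-combine i j)

------------------------------------------------------------------------
-- Great-circle thrackles

SameEdge : {V : Set} → (u v x y : V) → Set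
SameEdge u v x y = (u ≡ x × v ≡ y) ⊎ (u ≡ y × v ≡ x)

record GreatCircleThrackle (G : Graph) : Set where
  field
    pos : Vertex G → S²

    -- The values of kind off the edges of G are irrelevant.
    kind     : Vertex G → Vertex G → ArcKind
    kind-sym : ∀ u v → kind u v ≡ kind v u

    distinct     : ∀ {u v} → u ≢ v → ¬ (pos u ≈ˢ pos v)
    nonantipodal : ∀ {u v} → u ≢ v → ¬ Antipodal (pos u) (pos v)
    noncocircular : ∀ {u v w} → u ≢ v → v ≢ w → u ≢ w →
      ¬ (∃[ C ] (OnCircle C (pos u) × OnCircle C (pos v) × OnCircle C (pos w)))

  OnEdge : (u v : Vertex G) → S² → Set
  OnEdge u v = OnArc (kind u v) (pos u) (pos v)

  -- No separate clause says that an edge does not cross itself: an arc of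
  -- a great circle of length less than 2π never does.
  field
    thrackle : ∀ {u v x y} → Adj G u v → Adj G x y → ¬ SameEdge u v x y →
      ∃[ p ] ((OnEdge u v p × OnEdge x y p) ×
              (∀ q → OnEdge u v q → OnEdge x y q → q ≈ˢ p))

{-# OPTIONS --safe #-}

-- Disjoint arcs ab and cd lie on great circles that meet in the two points
-- ± (a × b) × (c × d), and the coefficients of these points in terms of a, b and
-- of c, d are determinants of vertices.  So whether the arcs meet exactly once is
-- decided by which of them are long and by the signs of these determinants.  Two
-- long arcs from a vertex a are impossible, as both contain - a.
--
-- Let z be the centre.  If all edges at z are short, the circle through one of
-- them, za, separates the other two, zp and zq.  The next edge ab meets both, so
-- it is long, and hence bc is short.  As bc crosses za, zp and zq, the short arc
-- complementary to ab crosses zp or zq, which ab therefore misses.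
--
-- If zu is long, the next edge ut is short, crosses the other two edges zv and
-- zw at z, and so puts v and w on one side of the circle through zu.  Name them
-- so that ut crosses zv before zw.  The edge wx cannot cross zv, zu and ut if it
-- is short.  If it is long, then xy is short, and the crossings of wx and xy with
-- these edges leave two configurations, each excluded by a three-term
-- Grassmann-Plücker relation.

module Submission where

open import Defs
open import Data.Empty using (⊥)
open import Data.Fin using (Fin; suc; inject₁)
open import Data.Fin.Patterns using (0F; 1F; 2F)
open import Data.Fin.Properties using (sequence)
open import Data.Nat as ℕ using (ℕ; _⊔_)
import Data.Nat.Properties as ℕₚ
open import Data.Product using (∃-syntax; _×_; _,_; proj₁; proj₂)
open import Data.Rational as ℚ using (ℚ; 0ℚ; 1ℚ; ½; ∣_∣)
import Data.Rational.Properties as ℚₚ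
open import Data.Rational.Solver using (module +-*-Solver)
open import Data.Sum using (_⊎_; inj₁; inj₂; [_,_]′; swap)
open import Effect.Monad using (RawMonad)
open import Function.Base using (_∘_; case_of_; flip)
open import Function.Bundles using (module Inverse)
open import Level using (0ℓ)
open import Relation.Binary.Bundles using (Setoid)
open import Relation.Binary.Construct.Closure.Symmetric using (fwd; bwd)
open import Relation.Binary.PropositionalEquality
  using (_≡_; _≢_; refl; sym; trans; cong; cong₂; subst; subst₂)
import Relation.Binary.Reasoning.Setoid as SetoidReasoning
open import Relation.Nullary using (¬_; Dec; yes; no; contradiction; _×-dec_; _⊎-dec_; ¬?)
open import Relation.Nullary.Decidable using (decidable-stable; ¬¬-excluded-middle)
open import Relation.Nullary.Negation using (¬¬-Monad; ¬¬-map)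

-- Real arithmetic

p≤∣p∣ : ∀ p → p ℚ.≤ ∣ p ∣
p≤∣p∣ p with ℚₚ.≤-total 0ℚ p
... | inj₁ 0≤p = ℚₚ.≤-reflexive (sym (ℚₚ.0≤p⇒∣p∣≡p 0≤p))
... | inj₂ p≤0 = ℚₚ.≤-trans p≤0 (ℚₚ.0≤∣p∣ p)

∣p-q∣≡∣q-p∣ : ∀ p q → ∣ p ℚ.- q ∣ ≡ ∣ q ℚ.- p ∣
∣p-q∣≡∣q-p∣ p q = trans (sym (ℚₚ.∣-p∣≡∣p∣ (p ℚ.- q))) (cong ∣_∣ (neg-sub p q))
  where
  open +-*-Solver
  neg-sub : ∀ p q → ℚ.- (p ℚ.- q) ≡ q ℚ.- p
  neg-sub = solve 2 (λ p q → :- (p :- q) := q :- p) refl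

below-close : ∀ {ε p q} → ε ℚ.≤ p → ∣ p ℚ.- q ∣ ℚ.< ½ ℚ.* ε → ½ ℚ.* ε ℚ.≤ q
below-close {ε} {p} {q} ε≤p close = begin
  ½ ℚ.* ε                          ≡⟨ half ε ⟩
  ε ℚ.- ½ ℚ.* ε                    ≤⟨ ℚₚ.+-mono-≤ ε≤p
                                        (ℚₚ.neg-antimono-≤ (ℚₚ.≤-trans (p≤∣p∣ (p ℚ.- q)) (ℚₚ.<⇒≤ close))) ⟩
  p ℚ.- (p ℚ.- q)                  ≡⟨ drop p q ⟩
  q                                ∎
  where
  open +-*-Solver
  open ℚₚ.≤-Reasoning
  half : ∀ ε → ½ ℚ.* ε ≡ ε ℚ.- ½ ℚ.* ε
  half = solve 1 (λ ε → con ½ :* ε := ε :- con ½ :* ε) refl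
  drop : ∀ p q → p ℚ.- (p ℚ.- q) ≡ q
  drop = solve 2 (λ p q → p :- (p :- q) := q) refl

m⊔n≤o⇒ : ∀ m n {o} → m ⊔ n ℕ.≤ o → m ℕ.≤ o × n ℕ.≤ o
m⊔n≤o⇒ m n le = ℕₚ.m⊔n≤o⇒m≤o m n le , ℕₚ.m⊔n≤o⇒n≤o m n le

pointwise : ∀ {x y} → (∀ n → seq x n ≡ seq y n) → x ≈ y
pointwise {x} {y} x≡y = mk≈ λ ε 0<ε → 0 , λ n _ →
  subst (λ t → ∣ t ℚ.- seq y n ∣ ℚ.< ε) (sym (x≡y n))
    (subst (λ t → ∣ t ∣ ℚ.< ε) (sym (ℚₚ.+-inverseʳ (seq y n))) 0<ε)

≈-refl : ∀ {x} → x ≈ x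
≈-refl = pointwise λ _ → refl

≈-sym : ∀ {x y} → x ≈ y → y ≈ x
≈-sym {x} {y} x≈y = mk≈ λ ε 0<ε →
  let N , close = eventually-close x≈y ε 0<ε
  in N , λ n N≤n → subst (ℚ._< ε) (∣p-q∣≡∣q-p∣ (seq x n) (seq y n)) (close n N≤n)

≈-trans : ∀ {x y z} → x ≈ y → y ≈ z → x ≈ z
≈-trans {x} {y} {z} x≈y y≈z = mk≈ λ ε 0<ε →
  let N₁ , close₁ = eventually-close x≈y (½ ℚ.* ε) (half-pos 0<ε)
      N₂ , close₂ = eventually-close y≈z (½ ℚ.* ε) (half-pos 0<ε)
  in N₁ ⊔ N₂ , λ n N≤n →
       let N₁≤n , N₂≤n = m⊔n≤o⇒ N₁ N₂ N≤n in begin-strict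
    ∣ seq x n ℚ.- seq z n ∣
      ≡⟨ cong ∣_∣ (split (seq x n) (seq y n) (seq z n)) ⟩
    ∣ (seq x n ℚ.- seq y n) ℚ.+ (seq y n ℚ.- seq z n) ∣
      ≤⟨ ℚₚ.∣p+q∣≤∣p∣+∣q∣ (seq x n ℚ.- seq y n) (seq y n ℚ.- seq z n) ⟩
    ∣ seq x n ℚ.- seq y n ∣ ℚ.+ ∣ seq y n ℚ.- seq z n ∣
      <⟨ ℚₚ.+-mono-< (close₁ n N₁≤n) (close₂ n N₂≤n) ⟩
    ½ ℚ.* ε ℚ.+ ½ ℚ.* ε
      ≡⟨ halves ε ⟩
    ε ∎
  where
  open +-*-Solver
  open ℚₚ.≤-Reasoning
  split : ∀ p q r → p ℚ.- r ≡ (p ℚ.- q) ℚ.+ (q ℚ.- r)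
  split = solve 3 (λ p q r → p :- r := (p :- q) :+ (q :- r)) refl

+-cong : ∀ {x x′ y y′} → x ≈ x′ → y ≈ y′ → x + y ≈ x′ + y′
+-cong {x} {x′} {y} {y′} x≈x′ y≈y′ = mk≈ λ ε 0<ε →
  let N₁ , close₁ = eventually-close x≈x′ (½ ℚ.* ε) (half-pos 0<ε)
      N₂ , close₂ = eventually-close y≈y′ (½ ℚ.* ε) (half-pos 0<ε)
  in N₁ ⊔ N₂ , λ n N≤n →
       let N₁≤n , N₂≤n = m⊔n≤o⇒ N₁ N₂ N≤n in begin-strict
    ∣ (seq x n ℚ.+ seq y n) ℚ.- (seq x′ n ℚ.+ seq y′ n) ∣
      ≡⟨ cong ∣_∣ (split (seq x n) (seq y n) (seq x′ n) (seq y′ n)) ⟩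
    ∣ (seq x n ℚ.- seq x′ n) ℚ.+ (seq y n ℚ.- seq y′ n) ∣
      ≤⟨ ℚₚ.∣p+q∣≤∣p∣+∣q∣ (seq x n ℚ.- seq x′ n) (seq y n ℚ.- seq y′ n) ⟩
    ∣ seq x n ℚ.- seq x′ n ∣ ℚ.+ ∣ seq y n ℚ.- seq y′ n ∣
      <⟨ ℚₚ.+-mono-< (close₁ n N₁≤n) (close₂ n N₂≤n) ⟩
    ½ ℚ.* ε ℚ.+ ½ ℚ.* ε
      ≡⟨ halves ε ⟩
    ε ∎
  where
  open +-*-Solver
  open ℚₚ.≤-Reasoning
  split : ∀ p q p′ q′ → (p ℚ.+ q) ℚ.- (p′ ℚ.+ q′) ≡ (p ℚ.- p′) ℚ.+ (q ℚ.- q′)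
  split = solve 4 (λ p q p′ q′ → (p :+ q) :- (p′ :+ q′) := (p :- p′) :+ (q :- q′)) refl

*-cong : ∀ {x x′ y y′} → x ≈ x′ → y ≈ y′ → x * y ≈ x′ * y′
*-cong {x} {x′} {y} {y′} x≈x′ y≈y′ = mk≈ λ ε 0<ε →
  let A , 0<A , N₁ , x≤A  = bounded (cauchy x)
      B , 0<B , N₂ , y′≤B = bounded (cauchy y′)
      α , 0<α , Aα≡½ε = shrink 0<A (half-pos 0<ε)
      β , 0<β , Bβ≡½ε = shrink 0<B (half-pos 0<ε)
      N₃ , close₃ = eventually-close x≈x′ β 0<β
      N₄ , close₄ = eventually-close y≈y′ α 0<α
  in (N₁ ⊔ N₂) ⊔ (N₃ ⊔ N₄) , λ n N≤n →
       let N₁₂≤n , N₃₄≤n = m⊔n≤o⇒ (N₁ ⊔ N₂) (N₃ ⊔ N₄) N≤n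
           N₁≤n , N₂≤n = m⊔n≤o⇒ N₁ N₂ N₁₂≤n
           N₃≤n , N₄≤n = m⊔n≤o⇒ N₃ N₄ N₃₄≤n
       in subst (∣ seq x n ℚ.* seq y n ℚ.- seq x′ n ℚ.* seq y′ n ∣ ℚ.<_)
            (trans (cong₂ ℚ._+_ Aα≡½ε Bβ≡½ε) (halves ε))
            (*-close (seq x n) (seq y n) (seq x′ n) (seq y′ n) 0<A 0<B
              (x≤A n N₁≤n) (y′≤B n N₂≤n) (close₃ n N₃≤n) (close₄ n N₄≤n))

*-congˡ : ∀ {x y y′} → y ≈ y′ → x * y ≈ x * y′
*-congˡ = *-cong ≈-refl

*-congʳ : ∀ {x x′ y} → x ≈ x′ → x * y ≈ x′ * y
*-congʳ x≈x′ = *-cong x≈x′ ≈-refl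

-‿cong : ∀ {x y} → x ≈ y → - x ≈ - y
-‿cong {x} {y} x≈y = ≈-trans (neg≈ x) (≈-trans (*-congˡ x≈y) (≈-sym (neg≈ y)))
  where
  open +-*-Solver
  neg≈ : ∀ z → - z ≈ fromℚ (ℚ.- 1ℚ) * z
  neg≈ z = pointwise λ n → solve 1 (λ z → :- z := con (ℚ.- 1ℚ) :* z) refl (seq z n)

above⇒0< : ∀ {x ε N} → 0ℚ ℚ.< ε → (∀ n → N ℕ.≤ n → ε ℚ.≤ seq x n) → 0ℝ < x
above⇒0< {x} {ε} {N} 0<ε above = mk< (ε , 0<ε , N , λ n N≤n →
  subst (ℚ._≤ seq x n) (sym (ℚₚ.+-identityˡ ε)) (above n N≤n))

0<⇒above : ∀ {x} → 0ℝ < x → ∃[ ε ] (0ℚ ℚ.< ε × ∃[ N ] (∀ n → N ℕ.≤ n → ε ℚ.≤ seq x n))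
0<⇒above {x} (mk< (ε , 0<ε , N , below)) = ε , 0<ε , N , λ n N≤n →
  subst (ℚ._≤ seq x n) (ℚₚ.+-identityˡ ε) (below n N≤n)

0<-resp-≈ : ∀ {x y} → x ≈ y → 0ℝ < x → 0ℝ < y
0<-resp-≈ x≈y 0<x =
  let ε , 0<ε , N₁ , ε≤x = 0<⇒above 0<x
      N₂ , close = eventually-close x≈y (½ ℚ.* ε) (half-pos 0<ε)
  in above⇒0< {N = N₁ ⊔ N₂} (half-pos 0<ε) λ n N≤n →
       let N₁≤n , N₂≤n = m⊔n≤o⇒ N₁ N₂ N≤n
       in below-close (ε≤x n N₁≤n) (close n N₂≤n)

0<+ : ∀ {x y} → 0ℝ < x → 0ℝ < y → 0ℝ < x + y
0<+ {x} {y} 0<x 0<y =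
  let ε , 0<ε , N₁ , ε≤x = 0<⇒above 0<x
      δ , 0<δ , N₂ , δ≤y = 0<⇒above 0<y
  in above⇒0< {N = N₁ ⊔ N₂} (ℚₚ.+-mono-< 0<ε 0<δ) λ n N≤n →
       let N₁≤n , N₂≤n = m⊔n≤o⇒ N₁ N₂ N≤n
       in ℚₚ.+-mono-≤ (ε≤x n N₁≤n) (δ≤y n N₂≤n)

ℚ-0<* : ∀ {p q} → 0ℚ ℚ.< p → 0ℚ ℚ.< q → 0ℚ ℚ.< p ℚ.* q
ℚ-0<* {p} {q} 0<p 0<q =
  subst (ℚ._< p ℚ.* q) (ℚₚ.*-zeroʳ p) (ℚₚ.*-monoʳ-<-pos p {{ℚ.positive 0<p}} 0<q)

0<* : ∀ {x y} → 0ℝ < x → 0ℝ < y → 0ℝ < x * y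
0<* {x} {y} 0<x 0<y =
  let ε , 0<ε , N₁ , ε≤x = 0<⇒above 0<x
      δ , 0<δ , N₂ , δ≤y = 0<⇒above 0<y
  in above⇒0< {N = N₁ ⊔ N₂} (ℚ-0<* 0<ε 0<δ) λ n N≤n →
       let N₁≤n , N₂≤n = m⊔n≤o⇒ N₁ N₂ N≤n
       in *-mono 0<ε 0<δ (ε≤x n N₁≤n) (δ≤y n N₂≤n)
  where
  *-mono : ∀ {ε δ p q} → 0ℚ ℚ.< ε → 0ℚ ℚ.< δ → ε ℚ.≤ p → δ ℚ.≤ q → ε ℚ.* δ ℚ.≤ p ℚ.* q
  *-mono {ε} {δ} {p} {q} 0<ε 0<δ ε≤p δ≤q = ℚₚ.≤-trans
    (ℚₚ.*-monoˡ-≤-nonNeg ε {{ℚ.nonNegative (ℚₚ.<⇒≤ 0<ε)}} δ≤q)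
    (ℚₚ.*-monoʳ-≤-nonNeg q {{ℚ.nonNegative (ℚₚ.≤-trans (ℚₚ.<⇒≤ 0<δ) δ≤q)}} ε≤p)

-- If `x` is eventually at most `B` and `x * y` eventually at least `δ`, then `y` is eventually at
-- least `η` = `δ / B`.
0<*-cancelˡ : ∀ {x y} → 0ℝ < x → 0ℝ < x * y → 0ℝ < y
0<*-cancelˡ {x} {y} 0<x 0<xy =
  let ε , 0<ε , N₁ , ε≤x  = 0<⇒above 0<x
      δ , 0<δ , N₂ , δ≤xy = 0<⇒above 0<xy
      B , 0<B , N₃ , x≤B  = bounded (cauchy x)
      η , 0<η , Bη≡δ = shrink 0<B 0<δ
  in above⇒0< {N = N₁ ⊔ (N₂ ⊔ N₃)} 0<η λ n N≤n →
       let N₁≤n , N₂₃≤n = m⊔n≤o⇒ N₁ (N₂ ⊔ N₃) N≤n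
           N₂≤n , N₃≤n  = m⊔n≤o⇒ N₂ N₃ N₂₃≤n
       in divide (ℚₚ.<-≤-trans 0<ε (ε≤x n N₁≤n)) 0<η
            (ℚₚ.≤-trans (p≤∣p∣ (seq x n)) (x≤B n N₃≤n))
            (subst (ℚ._≤ seq x n ℚ.* seq y n) (sym Bη≡δ) (δ≤xy n N₂≤n))
  where
  divide : ∀ {p q B η} → 0ℚ ℚ.< p → 0ℚ ℚ.< η → p ℚ.≤ B → B ℚ.* η ℚ.≤ p ℚ.* q → η ℚ.≤ q
  divide {p} 0<p 0<η p≤B Bη≤pq = ℚₚ.*-cancelˡ-≤-pos p {{ℚ.positive 0<p}} (ℚₚ.≤-trans
    (ℚₚ.*-monoʳ-≤-nonNeg _ {{ℚ.nonNegative (ℚₚ.<⇒≤ 0<η)}} p≤B) Bη≤pq)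

0≮0 : ¬ (0ℝ < 0ℝ)
0≮0 0<0 = let ε , 0<ε , N , ε≤0 = 0<⇒above 0<0
          in ℚₚ.<-irrefl refl (ℚₚ.<-≤-trans 0<ε (ε≤0 N ℕₚ.≤-refl))

0<-asym : ∀ {x} → 0ℝ < x → ¬ (0ℝ < - x)
0<-asym {x} 0<x 0<-x =
  0≮0 (0<-resp-≈ (pointwise λ n → ℚₚ.+-inverseʳ (seq x n)) (0<+ 0<x 0<-x))

-- A term of size at least `ε` beyond the Cauchy index for `½ ε` keeps all later terms at distance
-- at least `½ ε` from zero on its side, which would give `x` a sign. This makes equality of reals
-- provable by refuting both signs.
≮0∧≯0⇒≈0 : ∀ {x} → ¬ (0ℝ < x) → ¬ (0ℝ < - x) → x ≈ 0ℝ
≮0∧≯0⇒≈0 {x} 0≮x 0≮-x = mk≈ λ ε 0<ε →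
  let N₁ , close₁ = cauchy x     (½ ℚ.* ε) (half-pos 0<ε)
      N₂ , close₂ = cauchy (- x) (½ ℚ.* ε) (half-pos 0<ε)
  in N₁ ⊔ N₂ , λ n N≤n →
       let N₁≤n , N₂≤n = m⊔n≤o⇒ N₁ N₂ N≤n
       in small n 0<ε
            (λ ε≤x → 0≮x (above⇒0< {N = N₁} (half-pos 0<ε) λ m N₁≤m →
               below-close ε≤x (close₁ n m N₁≤n N₁≤m)))
            (λ ε≤-x → 0≮-x (above⇒0< {N = N₂} (half-pos 0<ε) λ m N₂≤m →
               below-close ε≤-x (close₂ n m N₂≤n N₂≤m)))
  where
  small : ∀ n {ε} → 0ℚ ℚ.< ε → ¬ (ε ℚ.≤ seq x n) → ¬ (ε ℚ.≤ ℚ.- seq x n) →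
          ∣ seq x n ℚ.- 0ℚ ∣ ℚ.< ε
  small n {ε} 0<ε ε≰x ε≰-x
    rewrite ℚₚ.+-identityʳ (seq x n) with ℚₚ.∣p∣≡p∨∣p∣≡-p (seq x n)
  ... | inj₁ eq = subst (ℚ._< ε) (sym eq) (ℚₚ.≰⇒> ε≰x)
  ... | inj₂ eq = subst (ℚ._< ε) (sym eq) (ℚₚ.≰⇒> ε≰-x)

ℝ-setoid : Setoid 0ℓ 0ℓ
ℝ-setoid = record
  { Carrier       = ℝ
  ; _≈_           = _≈_
  ; isEquivalence = record { refl = ≈-refl ; sym = ≈-sym ; trans = ≈-trans } }

module ≈-Reasoning = SetoidReasoning ℝ-setoid

+-comm : ∀ x y → x + y ≈ y + x
+-comm x y = pointwise λ n → ℚₚ.+-comm (seq x n) (seq y n)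

*-comm : ∀ x y → x * y ≈ y * x
*-comm x y = pointwise λ n → ℚₚ.*-comm (seq x n) (seq y n)

-- Neither factor can be tested for zero, so both signs of `y` are refuted: with `y` signed, either
-- sign of `x` would make the product nonzero, whence `x ≈ 0ℝ`.
zero-product : ∀ {x y} → ¬ x ≈ 0ℝ → x * y ≈ 0ℝ → y ≈ 0ℝ
zero-product {x} {y} x≉0 xy≈0 = ≮0∧≯0⇒≈0
  (λ 0<y → x≉0 (≮0∧≯0⇒≈0
    (λ 0<x  → 0≮0 (0<-resp-≈ xy≈0 (0<* 0<x 0<y)))
    (λ 0<-x → 0≮0 (0<-resp-≈ (≈-trans (neg-left x y) -xy≈0) (0<* 0<-x 0<y)))))
  (λ 0<-y → x≉0 (≮0∧≯0⇒≈0
    (λ 0<x  → 0≮0 (0<-resp-≈ (≈-trans (neg-right x y) -xy≈0) (0<* 0<x 0<-y)))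
    (λ 0<-x → 0≮0 (0<-resp-≈ (≈-trans (neg-both x y) xy≈0) (0<* 0<-x 0<-y)))))
  where
  open +-*-Solver
  -xy≈0 : - (x * y) ≈ 0ℝ
  -xy≈0 = ≈-trans (-‿cong xy≈0) (pointwise λ _ → refl)
  neg-left : ∀ x y → - x * y ≈ - (x * y)
  neg-left x y = pointwise λ n →
    solve 2 (λ x y → :- x :* y := :- (x :* y)) refl (seq x n) (seq y n)
  neg-right : ∀ x y → x * - y ≈ - (x * y)
  neg-right x y = pointwise λ n →
    solve 2 (λ x y → x :* :- y := :- (x :* y)) refl (seq x n) (seq y n)
  neg-both : ∀ x y → - x * - y ≈ x * y
  neg-both x y = pointwise λ n →
    solve 2 (λ x y → :- x :* :- y := x :* y) refl (seq x n) (seq y n)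

-- Determinants

infixl 7 _⨯_

_⨯_ : ℝ³ → ℝ³ → ℝ³
(u ⨯ v) 0F = u 1F * v 2F + - (u 2F * v 1F)
(u ⨯ v) 1F = u 2F * v 0F + - (u 0F * v 2F)
(u ⨯ v) 2F = u 0F * v 1F + - (u 1F * v 0F)

det : ℝ³ → ℝ³ → ℝ³ → ℝ
det x y z = x ∙ (y ⨯ z)

∙-congʳ : ∀ {u u′} v → u ≈³ u′ → u ∙ v ≈ u′ ∙ v
∙-congʳ v u≈u′ = +-cong (+-cong (*-congʳ (u≈u′ 0F)) (*-congʳ (u≈u′ 1F))) (*-congʳ (u≈u′ 2F))

⨯-zeroˡ : ∀ {u} v → u ≈³ 0³ → u ⨯ v ≈³ 0³
⨯-zeroˡ v u≈0 = λ
  { 0F → vanish (v 2F) (v 1F) (u≈0 1F) (u≈0 2F)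
  ; 1F → vanish (v 0F) (v 2F) (u≈0 2F) (u≈0 0F)
  ; 2F → vanish (v 1F) (v 0F) (u≈0 0F) (u≈0 1F) }
  where
  open +-*-Solver
  vanish : ∀ {a b} x y → a ≈ 0ℝ → b ≈ 0ℝ → a * x + - (b * y) ≈ 0ℝ
  vanish x y a≈0 b≈0 = ≈-trans (+-cong (*-congʳ a≈0) (-‿cong (*-congʳ b≈0)))
    (pointwise λ n → solve 2 (λ x y →
      con 0ℚ :* x :+ :- (con 0ℚ :* y) := con 0ℚ) refl (seq x n) (seq y n))

∙-comm : ∀ u v → u ∙ v ≈ v ∙ u
∙-comm u v = +-cong (+-cong (*-comm (u 0F) (v 0F)) (*-comm (u 1F) (v 1F))) (*-comm (u 2F) (v 2F))

module Identities where
  open +-*-Solver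

  -- The ring solver handles scalars only. Vectors become triples of polynomials, and the products
  -- below copy the formulas of `_∙_` and `_⨯_`, so that evaluation gives back the terms of the real
  -- sequences.
  Polynomial³ : _ → Set
  Polynomial³ n = Polynomial n × Polynomial n × Polynomial n

  infixl 7 _:∙_ _:⨯_

  _:∙_ : ∀ {n} → Polynomial³ n → Polynomial³ n → Polynomial n
  (x₀ , x₁ , x₂) :∙ (y₀ , y₁ , y₂) = x₀ :* y₀ :+ x₁ :* y₁ :+ x₂ :* y₂

  _:⨯_ : ∀ {n} → Polynomial³ n → Polynomial³ n → Polynomial³ n
  (x₀ , x₁ , x₂) :⨯ (y₀ , y₁ , y₂) =
    x₁ :* y₂ :+ :- (x₂ :* y₁) , x₂ :* y₀ :+ :- (x₀ :* y₂) , x₀ :* y₁ :+ :- (x₁ :* y₀)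

  :det : ∀ {n} (x y z : Polynomial³ n) → Polynomial n
  :det x y z = x :∙ (y :⨯ z)

  ∙-linear : ∀ α β a b c → (α *³ a +³ β *³ b) ∙ c ≈ α * (a ∙ c) + β * (b ∙ c)
  ∙-linear α β a b c = pointwise λ n →
    solve 11 (λ α β a₀ a₁ a₂ b₀ b₁ b₂ c₀ c₁ c₂ →
        let a = a₀ , a₁ , a₂ ; b = b₀ , b₁ , b₂ ; c = c₀ , c₁ , c₂ in
        (α :* a₀ :+ β :* b₀ , α :* a₁ :+ β :* b₁ , α :* a₂ :+ β :* b₂) :∙ c
        := α :* (a :∙ c) :+ β :* (b :∙ c)) refl
      (seq α n) (seq β n)
      (seq (a 0F) n) (seq (a 1F) n) (seq (a 2F) n)
      (seq (b 0F) n) (seq (b 1F) n) (seq (b 2F) n)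
      (seq (c 0F) n) (seq (c 1F) n) (seq (c 2F) n)

  det-cyclic : ∀ x y z → det x y z ≈ det y z x
  det-cyclic x y z = pointwise λ n →
    solve 9 (λ x₀ x₁ x₂ y₀ y₁ y₂ z₀ z₁ z₂ →
        let x = x₀ , x₁ , x₂ ; y = y₀ , y₁ , y₂ ; z = z₀ , z₁ , z₂ in
        :det x y z := :det y z x) refl
      (seq (x 0F) n) (seq (x 1F) n) (seq (x 2F) n)
      (seq (y 0F) n) (seq (y 1F) n) (seq (y 2F) n)
      (seq (z 0F) n) (seq (z 1F) n) (seq (z 2F) n)

  det-swap : ∀ x y z → - det x y z ≈ det y x z
  det-swap x y z = pointwise λ n →
    solve 9 (λ x₀ x₁ x₂ y₀ y₁ y₂ z₀ z₁ z₂ →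
        let x = x₀ , x₁ , x₂ ; y = y₀ , y₁ , y₂ ; z = z₀ , z₁ , z₂ in
        :- :det x y z := :det y x z) refl
      (seq (x 0F) n) (seq (x 1F) n) (seq (x 2F) n)
      (seq (y 0F) n) (seq (y 1F) n) (seq (y 2F) n)
      (seq (z 0F) n) (seq (z 1F) n) (seq (z 2F) n)

  det-xxy : ∀ x y → det x x y ≈ 0ℝ
  det-xxy x y = pointwise λ n →
    solve 6 (λ x₀ x₁ x₂ y₀ y₁ y₂ →
        let x = x₀ , x₁ , x₂ ; y = y₀ , y₁ , y₂ in
        :det x x y := con 0ℚ) refl
      (seq (x 0F) n) (seq (x 1F) n) (seq (x 2F) n)
      (seq (y 0F) n) (seq (y 1F) n) (seq (y 2F) n)

  -- `det x` is an area form on the plane obtained by dividing out `x`; this is the three-term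
  -- relation among the areas spanned there by four vectors.
  grassmann-plücker : ∀ x a b c d →
    det x a b * det x c d + det x b c * det x a d + det x c a * det x b d ≈ 0ℝ
  grassmann-plücker x a b c d = pointwise λ n →
    solve 15 (λ x₀ x₁ x₂ a₀ a₁ a₂ b₀ b₁ b₂ c₀ c₁ c₂ d₀ d₁ d₂ →
        let x = x₀ , x₁ , x₂ ; a = a₀ , a₁ , a₂ ; b = b₀ , b₁ , b₂
            c = c₀ , c₁ , c₂ ; d = d₀ , d₁ , d₂ in
        :det x a b :* :det x c d :+ :det x b c :* :det x a d :+ :det x c a :* :det x b d
        := con 0ℚ) refl
      (seq (x 0F) n) (seq (x 1F) n) (seq (x 2F) n)
      (seq (a 0F) n) (seq (a 1F) n) (seq (a 2F) n)
      (seq (b 0F) n) (seq (b 1F) n) (seq (b 2F) n)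
      (seq (c 0F) n) (seq (c 1F) n) (seq (c 2F) n)
      (seq (d 0F) n) (seq (d 1F) n) (seq (d 2F) n)

  -- The double cross product formula splits `y` into its part along `x` and its part orthogonal to
  -- `x`. A vanishing `x ⨯ y` thus makes `y` a multiple of `x` when `x` is a unit vector.
  triple-product : ∀ x y i → (x ∙ x) * y i ≈ (x ∙ y) * x i + (x ⨯ y ⨯ x) i
  triple-product x y 0F = pointwise λ n →
    solve 6 (λ x₀ x₁ x₂ y₀ y₁ y₂ →
        let x = x₀ , x₁ , x₂ ; y = y₀ , y₁ , y₂ in
        (x :∙ x) :* y₀ := (x :∙ y) :* x₀ :+ proj₁ (x :⨯ y :⨯ x)) refl
      (seq (x 0F) n) (seq (x 1F) n) (seq (x 2F) n)
      (seq (y 0F) n) (seq (y 1F) n) (seq (y 2F) n)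
  triple-product x y 1F = pointwise λ n →
    solve 6 (λ x₀ x₁ x₂ y₀ y₁ y₂ →
        let x = x₀ , x₁ , x₂ ; y = y₀ , y₁ , y₂ in
        (x :∙ x) :* y₁ := (x :∙ y) :* x₁ :+ proj₁ (proj₂ (x :⨯ y :⨯ x))) refl
      (seq (x 0F) n) (seq (x 1F) n) (seq (x 2F) n)
      (seq (y 0F) n) (seq (y 1F) n) (seq (y 2F) n)
  triple-product x y 2F = pointwise λ n →
    solve 6 (λ x₀ x₁ x₂ y₀ y₁ y₂ →
        let x = x₀ , x₁ , x₂ ; y = y₀ , y₁ , y₂ in
        (x :∙ x) :* y₂ := (x :∙ y) :* x₂ :+ proj₂ (proj₂ (x :⨯ y :⨯ x))) refl
      (seq (x 0F) n) (seq (x 1F) n) (seq (x 2F) n)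
      (seq (y 0F) n) (seq (y 1F) n) (seq (y 2F) n)

open Identities

-- Signs of reals and independence of unit vectors

Signed : ℝ → Set
Signed x = 0ℝ < x ⊎ 0ℝ < - x

-- Which sign a nonzero real has cannot be decided constructively; that it has one is only
-- irrefutable.
¬¬-signed : ∀ {x} → ¬ x ≈ 0ℝ → ¬ ¬ Signed x
¬¬-signed x≉0 unsigned = x≉0 (≮0∧≯0⇒≈0 (unsigned ∘ inj₁) (unsigned ∘ inj₂))

-x*-y≈x*y : ∀ x y → - x * - y ≈ x * y
-x*-y≈x*y x y = pointwise λ n → solve 2 (λ x y → :- x :* :- y := x :* y) refl (seq x n) (seq y n)
  where open +-*-Solver

0<x*x : ∀ {x} → Signed x → 0ℝ < x * x
0<x*x     (inj₁ 0<x)  = 0<* 0<x 0<x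
0<x*x {x} (inj₂ 0<-x) = 0<-resp-≈ (-x*-y≈x*y x x) (0<* 0<-x 0<-x)

same-sign : ∀ {x y} → 0ℝ < x * y → (0ℝ < x → 0ℝ < y) × (0ℝ < - x → 0ℝ < - y)
same-sign {x} {y} 0<xy =
  (λ 0<x → 0<*-cancelˡ 0<x 0<xy) ,
  (λ 0<-x → 0<*-cancelˡ 0<-x (0<-resp-≈ (≈-sym (-x*-y≈x*y x y)) 0<xy))

signed-factor : ∀ {x y} → 0ℝ < x * y → Signed y → Signed x
signed-factor {x} {y} 0<xy = [ inj₁ ∘ proj₁ back , inj₂ ∘ proj₂ back ]′
  where back = same-sign (0<-resp-≈ (*-comm x y) 0<xy)

-- The hypothesis turns `(β * y) * (α * x)` into the square of `β * x`. So if `β` has the sign of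
-- `y`, then `α` has the sign of `x`.
0<-proportional : ∀ {α β x y} → α * y ≈ β * x → 0ℝ < β * y → Signed x → Signed y → 0ℝ < α * x
0<-proportional {α} {β} {x} {y} αy≈βx 0<βy sx sy = 0<*-cancelˡ 0<βy
  (0<-resp-≈ eq (0<* (0<x*x (signed-factor 0<βy sy)) (0<x*x sx)))
  where
  open ≈-Reasoning
  open +-*-Solver
  eq : (β * β) * (x * x) ≈ (β * y) * (α * x)
  eq = begin
    (β * β) * (x * x)  ≈⟨ pointwise (λ n → solve 2 (λ β x →
                            (β :* β) :* (x :* x) := (β :* x) :* (β :* x)) refl (seq β n) (seq x n)) ⟩
    (β * x) * (β * x)  ≈⟨ *-congʳ (≈-sym αy≈βx) ⟩
    (α * y) * (β * x)  ≈⟨ pointwise (λ n → solve 4 (λ α β x y →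
                            (α :* y) :* (β :* x) := (β :* y) :* (α :* x)) refl
                            (seq α n) (seq β n) (seq x n) (seq y n)) ⟩
    (β * y) * (α * x)  ∎

x≈-x⇒x≈0 : ∀ {x} → - x ≈ x → x ≈ 0ℝ
x≈-x⇒x≈0 -x≈x = ≮0∧≯0⇒≈0
  (λ 0<x → 0<-asym 0<x (0<-resp-≈ (≈-sym -x≈x) 0<x))
  (λ 0<-x → 0<-asym (0<-resp-≈ -x≈x 0<-x) 0<-x)

0<1 : 0ℝ < 1ℝ
0<1 = above⇒0< {N = 0} (ℚₚ.positive⁻¹ 1ℚ) λ _ _ → ℚₚ.≤-refl

vec≉0 : ∀ p → ¬ (vec p ≈³ 0³)
vec≉0 p p≈0 = 0≮0 (0<-resp-≈ 1≈0 0<1)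
  where
  open ≈-Reasoning
  1≈0 : 1ℝ ≈ 0ℝ
  1≈0 = begin
    1ℝ             ≈⟨ unit p ⟨
    vec p ∙ vec p  ≈⟨ ∙-congʳ (vec p) p≈0 ⟩
    0³ ∙ vec p     ≈⟨ pointwise (λ n → solve 3 (λ x y z →
                        con 0ℚ :* x :+ con 0ℚ :* y :+ con 0ℚ :* z := con 0ℚ) refl
                        (seq (vec p 0F) n) (seq (vec p 1F) n) (seq (vec p 2F) n)) ⟩
    0ℝ             ∎
    where open +-*-Solver

antipode : S² → S²
antipode p = record
  { vec  = -³ vec p
  ; unit = ≈-trans
      (+-cong (+-cong (-x*-y≈x*y _ _) (-x*-y≈x*y _ _)) (-x*-y≈x*y _ _)) (unit p) }

antipode≉ : ∀ p → ¬ (antipode p ≈ˢ p)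
antipode≉ p -p≈p = vec≉0 p (λ i → x≈-x⇒x≈0 (-p≈p i))

-- A zero product gives `q = s p` with `s` the scalar product, and unit length forces `s² = 1`. The
-- root `-1` makes the points antipodal, the root `1` makes them equal.
⨯≉0 : ∀ p q → ¬ p ≈ˢ q → ¬ Antipodal p q → ¬ (vec p ⨯ vec q ≈³ 0³)
⨯≉0 p q p≉q p≉-q p⨯q≈0 = p≉q λ i → begin
  vec p i       ≈⟨ pointwise (λ n → ℚₚ.*-identityˡ _) ⟨
  1ℝ * vec p i  ≈⟨ *-congʳ s≈1 ⟨
  s * vec p i   ≈⟨ q≈sp i ⟨
  vec q i       ∎
  where
  open ≈-Reasoning
  open +-*-Solver
  s : ℝ
  s = vec p ∙ vec q
  q≈sp : vec q ≈³ s *³ vec p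
  q≈sp i = begin
    vec q i                                      ≈⟨ pointwise (λ n → ℚₚ.*-identityˡ _) ⟨
    1ℝ * vec q i                                 ≈⟨ *-congʳ (unit p) ⟨
    (vec p ∙ vec p) * vec q i                    ≈⟨ triple-product (vec p) (vec q) i ⟩
    s * vec p i + (vec p ⨯ vec q ⨯ vec p) i      ≈⟨ +-cong ≈-refl (⨯-zeroˡ (vec p) p⨯q≈0 i) ⟩
    s * vec p i + 0ℝ                             ≈⟨ pointwise (λ n → ℚₚ.+-identityʳ _) ⟩
    s * vec p i                                  ∎
  s²≈1 : s * s ≈ 1ℝ
  s²≈1 = begin
    s * s                  ≈⟨ pointwise (λ n → solve 7 (λ s x₀ x₁ x₂ y₀ y₁ y₂ →
                                let x = x₀ , x₁ , x₂ ; y = y₀ , y₁ , y₂ in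
                                s :* (x :∙ y) := (s :* x₀ , s :* x₁ , s :* x₂) :∙ y) refl (seq s n)
                                (seq (vec p 0F) n) (seq (vec p 1F) n) (seq (vec p 2F) n)
                                (seq (vec q 0F) n) (seq (vec q 1F) n) (seq (vec q 2F) n)) ⟩
    (s *³ vec p) ∙ vec q   ≈⟨ ∙-congʳ (vec q) q≈sp ⟨
    vec q ∙ vec q          ≈⟨ unit q ⟩
    1ℝ                     ∎
  s+1≉0 : ¬ s + 1ℝ ≈ 0ℝ
  s+1≉0 s+1≈0 = p≉-q λ i → begin
    vec p i                                    ≈⟨ pointwise (λ n → solve 2 (λ s x →
                                                     x := (s :+ con 1ℚ) :* x :+ :- (s :* x)) refl
                                                     (seq s n) (seq (vec p i) n)) ⟩
    (s + 1ℝ) * vec p i + - (s * vec p i)       ≈⟨ +-cong (*-congʳ s+1≈0) (-‿cong (≈-sym (q≈sp i))) ⟩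
    0ℝ * vec p i + - vec q i                   ≈⟨ pointwise (λ n → solve 2 (λ x y →
                                                     con 0ℚ :* x :+ y := y) refl (seq (vec p i) n) _) ⟩
    - vec q i                                  ∎
  s-1≈0 : s + - 1ℝ ≈ 0ℝ
  s-1≈0 = zero-product s+1≉0 (begin
    (s + 1ℝ) * (s + - 1ℝ)  ≈⟨ pointwise (λ n → solve 1 (λ s → (s :+ con 1ℚ) :* (s :+ con (ℚ.- 1ℚ))
                                := s :* s :+ con (ℚ.- 1ℚ)) refl (seq s n)) ⟩
    s * s + - 1ℝ           ≈⟨ +-cong s²≈1 ≈-refl ⟩
    1ℝ + - 1ℝ              ≈⟨ pointwise (λ n → refl) ⟩
    0ℝ                     ∎)
  s≈1 : s ≈ 1ℝ
  s≈1 = begin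
    s                  ≈⟨ pointwise (λ n → solve 1 (λ s →
                            s := (s :+ con (ℚ.- 1ℚ)) :+ con 1ℚ) refl (seq s n)) ⟩
    (s + - 1ℝ) + 1ℝ    ≈⟨ +-cong s-1≈0 ≈-refl ⟩
    0ℝ + 1ℝ            ≈⟨ pointwise (λ n → refl) ⟩
    1ℝ                 ∎

-- Thrackles as sign patterns

-- `A` is to say that a point of the great circle lies inside the short arc; the long arc is the
-- complement. In general position the points considered are never endpoints.
Hits : ArcKind → Set → Set
Hits short A = A
Hits long  A = ¬ A

hits? : ∀ k {A : Set} → Dec A → Dec (Hits k A)
hits? short a? = a?
hits? long  a? = ¬? a?

module _ {V : Set} where

  -- The short arc from a to b contains (a × b) × (c × d), which is
  -- det d c b · a + det c d a · b.
  Across : (V → V → V → Set) → (a b c d : V) → Set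
  Across Ccw a b c d = Ccw d c b × Ccw c d a

  -- (a × b) × (c × d) lies on both of the arcs ab and cd, of kinds k and l.
  Meet : (V → V → V → Set) → (k l : ArcKind) (a b c d : V) → Set
  Meet Ccw k l a b c d = Hits k (Across Ccw a b c d) × Hits l (Across (flip Ccw) c d a b)

  -- Reversing the orientation replaces this point by its antipode.
  Crosses : (V → V → V → Set) → (k l : ArcKind) (a b c d : V) → Set
  Crosses Ccw k l a b c d =
    (Meet Ccw k l a b c d × ¬ Meet (flip Ccw) k l a b c d) ⊎
    (Meet (flip Ccw) k l a b c d × ¬ Meet Ccw k l a b c d)

  meet? : ∀ {Ccw} → (∀ a b c → Dec (Ccw a b c)) → ∀ k l a b c d → Dec (Meet Ccw k l a b c d)
  meet? ccw? k l a b c d =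
    hits? k (ccw? d c b ×-dec ccw? c d a) ×-dec hits? l (ccw? a b d ×-dec ccw? b a c)

  crosses? : ∀ {Ccw} → (∀ a b c → Dec (Ccw a b c)) → ∀ k l a b c d → Dec (Crosses Ccw k l a b c d)
  crosses? ccw? k l a b c d =
    (meet? ccw? k l a b c d ×-dec ¬? (meet? (flip ccw?) k l a b c d)) ⊎-dec
    (meet? (flip ccw?) k l a b c d ×-dec ¬? (meet? ccw? k l a b c d))

-- The combinatorial shadow of a drawing: a decidable orientation of triples, as in a uniform
-- oriented matroid of rank 3, together with the kinds of the arcs. The axioms are closed under
-- reversal of orientation.
record OrientedThrackle (G : Graph) : Set₁ where
  field
    Ccw  : (a b c : Vertex G) → Set
    ccw? : ∀ a b c → Dec (Ccw a b c)
    cyclic  : ∀ {a b c} → Ccw a b c → Ccw b c a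
    asym    : ∀ {a b c} → Ccw a b c → ¬ Ccw b a c
    connex  : ∀ {a b c} → a ≢ b → b ≢ c → a ≢ c → ¬ Ccw a b c → Ccw b a c
    -- If the directions from x towards a, b, c wind around x, no d sees all
    -- three of them on the same side.
    unsurrounded  : ∀ {x a b c d} → Ccw x a b → Ccw x b c → Ccw x c a →
                    Ccw x a d → Ccw x b d → ¬ Ccw x c d
    unsurrounded⁻ : ∀ {x a b c d} → Ccw a x b → Ccw b x c → Ccw c x a →
                    Ccw a x d → Ccw b x d → ¬ Ccw c x d
    kind     : (u v : Vertex G) → ArcKind
    kind-sym : ∀ u v → kind u v ≡ kind v u
    long-isolated : ∀ {a b c} → Adj G a b → Adj G a c → b ≢ c →
                    kind a b ≡ long → kind a c ≢ long
    crossing : ∀ {a b c d} → Adj G a b → Adj G c d → a ≢ c → a ≢ d → b ≢ c → b ≢ d →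
               Crosses Ccw (kind a b) (kind c d) a b c d

-- Reflecting the sphere reverses all orientations and keeps all crossings, so each case settled
-- below settles its mirror image too.
mirror : ∀ {G} → OrientedThrackle G → OrientedThrackle G
mirror T = record
  { Ccw  = λ a b c → Ccw b a c
  ; ccw? = λ a b c → ccw? b a c
  ; cyclic  = λ bac → cyclic (cyclic bac)
  ; asym    = λ bac abc → asym bac abc
  ; connex  = λ a≢b b≢c a≢c → connex (a≢b ∘ sym) a≢c b≢c
  ; unsurrounded  = unsurrounded⁻
  ; unsurrounded⁻ = unsurrounded
  ; kind     = kind
  ; kind-sym = kind-sym
  ; long-isolated = long-isolated
  ; crossing = λ ab cd a≢c a≢d b≢c b≢d → swap (crossing ab cd a≢c a≢d b≢c b≢d)
  }
  where open OrientedThrackle T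

-- From great-circle thrackles to sign patterns

restrict : ∀ {G H} → G Contains H → GreatCircleThrackle G → GreatCircleThrackle H
restrict (f , injective , adj) T = record
  { pos  = pos ∘ f
  ; kind = λ u v → kind (f u) (f v)
  ; kind-sym      = λ u v → kind-sym (f u) (f v)
  ; distinct      = λ u≢v → distinct (u≢v ∘ injective)
  ; nonantipodal  = λ u≢v → nonantipodal (u≢v ∘ injective)
  ; noncocircular = λ u≢v v≢w u≢w →
      noncocircular (u≢v ∘ injective) (v≢w ∘ injective) (u≢w ∘ injective)
  ; thrackle = λ uv xy different → thrackle (adj uv) (adj xy) λ
      { (inj₁ (fu≡fx , fv≡fy)) → different (inj₁ (injective fu≡fx , injective fv≡fy))
      ; (inj₂ (fu≡fy , fv≡fx)) → different (inj₂ (injective fu≡fy , injective fv≡fx)) }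
  }
  where open GreatCircleThrackle T

-- Double negation commutes with finite conjunctions, and the vertices are enumerated by some
-- `Fin n`.
¬¬-∀ : ∀ (G : Graph) {P : Vertex G → Set} → (∀ v → ¬ ¬ P v) → ¬ ¬ (∀ v → P v)
¬¬-∀ G {P} ¬¬P ¬∀P =
  sequence (RawMonad.rawApplicative ¬¬-Monad) {P = P ∘ from} (λ i → ¬¬P (from i))
    λ ∀P → ¬∀P λ v → subst P (strictlyInverseʳ v) (∀P (to v))
  where open Inverse (proj₂ (finite G))

-- The sign condition of `OnArc` split off from the coordinates, so that both kinds of arc can be
-- treated at once.
Coefficients : ArcKind → ℝ → ℝ → Set
Coefficients short α β = 0ℝ ≤ α × 0ℝ ≤ β
Coefficients long  α β = ¬ (0ℝ < α × 0ℝ < β)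

onArc : ∀ k {p q x} → OnArc k p q x →
        ∃[ α ] ∃[ β ] (vec x ≈³ α *³ vec p +³ β *³ vec q × Coefficients k α β)
onArc short on = on
onArc long  on = on

onArc⁻¹ : ∀ k {p q x} → ∃[ α ] ∃[ β ] (vec x ≈³ α *³ vec p +³ β *³ vec q × Coefficients k α β) →
        OnArc k p q x
onArc⁻¹ short on = on
onArc⁻¹ long  on = on

0<-⇒<0 : ∀ {x} → 0ℝ < - x → x < 0ℝ
0<-⇒<0 {x} 0<-x =
  let ε , 0<ε , N , ε≤-x = 0<⇒above 0<-x
  in mk< (ε , 0<ε , N , λ n N≤n →
       subst (seq x n ℚ.+ ε ℚ.≤_) (ℚₚ.+-inverseʳ (seq x n)) (ℚₚ.+-monoʳ-≤ (seq x n) (ε≤-x n N≤n)))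

<0⇒0<- : ∀ {x} → x < 0ℝ → 0ℝ < - x
<0⇒0<- {x} (mk< (ε , 0<ε , N , x+ε≤0)) = above⇒0< {N = N} 0<ε λ n N≤n →
  subst₂ ℚ._≤_ (cancel (seq x n) ε) (ℚₚ.+-identityʳ (ℚ.- seq x n))
    (ℚₚ.+-monoʳ-≤ (ℚ.- seq x n) (x+ε≤0 n N≤n))
  where
  open +-*-Solver
  cancel : ∀ p ε → ℚ.- p ℚ.+ (p ℚ.+ ε) ≡ ε
  cancel = solve 2 (λ p ε → :- p :+ (p :+ ε) := ε) refl

0<⇒0≤ : ∀ {x} → 0ℝ < x → 0ℝ ≤ x
0<⇒0≤ 0<x x<0 = 0<-asym 0<x (<0⇒0<- x<0)

0≤-signed : ∀ {x} → 0ℝ ≤ x → Signed x → 0ℝ < x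
0≤-signed 0≤x (inj₁ 0<x)  = 0<x
0≤-signed 0≤x (inj₂ 0<-x) = contradiction (0<-⇒<0 0<-x) 0≤x

module _ {α β x y} (0<αx : 0ℝ < α * x) (0<βy : 0ℝ < β * y) where

  private
    0<xα = 0<-resp-≈ (*-comm α x) 0<αx
    0<yβ = 0<-resp-≈ (*-comm β y) 0<βy

  -- `α` and `β` share the signs of `x` and `y`, so these can replace them. As no sign is zero, the
  -- weak inequalities of the closed short arc become strict.
  coefficients⇒hits : ∀ k → Signed x → Signed y → Coefficients k α β → Hits k (0ℝ < x × 0ℝ < y)
  coefficients⇒hits short sx sy (0≤α , 0≤β) =
    proj₁ (same-sign 0<αx) (0≤-signed 0≤α (signed-factor 0<αx sx)) ,
    proj₁ (same-sign 0<βy) (0≤-signed 0≤β (signed-factor 0<βy sy))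
  coefficients⇒hits long sx sy ¬0<αβ (0<x , 0<y) = ¬0<αβ
    (proj₁ (same-sign 0<xα) 0<x , proj₁ (same-sign 0<yβ) 0<y)

  -- The converse at the antipode: its coefficients are `- α` and `- β`, and `x⁻` and `y⁻` are the
  -- determinants in the reversed orientation.
  hits⇒-coefficients : ∀ k {x⁻ y⁻} → - x ≈ x⁻ → - y ≈ y⁻ →
                       Hits k (0ℝ < x⁻ × 0ℝ < y⁻) → Coefficients k (- α) (- β)
  hits⇒-coefficients short x⁻≈ y⁻≈ (0<-x , 0<-y) =
    0<⇒0≤ (proj₂ (same-sign 0<xα) (0<-resp-≈ (≈-sym x⁻≈) 0<-x)) ,
    0<⇒0≤ (proj₂ (same-sign 0<yβ) (0<-resp-≈ (≈-sym y⁻≈) 0<-y))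
  hits⇒-coefficients long x⁻≈ y⁻≈ miss (0<-α , 0<-β) =
    miss (0<-resp-≈ x⁻≈ (proj₂ (same-sign 0<αx) 0<-α) , 0<-resp-≈ y⁻≈ (proj₂ (same-sign 0<βy) 0<-β))

det-linear : ∀ {p a b α β} → p ≈³ α *³ a +³ β *³ b → ∀ x y →
             det p x y ≈ α * det a x y + β * det b x y
det-linear {a = a} {b} {α} {β} p≈ x y = ≈-trans (∙-congʳ (x ⨯ y) p≈) (∙-linear α β a b (x ⨯ y))

det-xyx : ∀ x y → det x y x ≈ 0ℝ
det-xyx x y = ≈-trans (det-cyclic x y x) (≈-trans (det-cyclic y x x) (det-xxy x y))

module Coordinates {a b c d p : ℝ³} {α β γ δ : ℝ}
  (p≈αa+βb : p ≈³ α *³ a +³ β *³ b) (p≈γc+δd : p ≈³ γ *³ c +³ δ *³ d) where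

  open ≈-Reasoning

  -- As `p` lies in the plane of `c` and `d`, `det p d c` vanishes; expanding it along `a` and `b`
  -- gives the proportion.
  α∝β : α * det c d a ≈ β * det d c b
  α∝β = begin
    α * det c d a        ≈⟨ pointwise (λ n → solve 3 (λ α x r →
                               α :* x := :- (α :* :- x :+ r) :+ r) refl
                               (seq α n) (seq (det c d a) n) (seq (β * det d c b) n)) ⟩
    - (α * - det c d a + β * det d c b) + β * det d c b  ≈⟨ +-cong (-‿cong p∈cd) ≈-refl ⟩
    - 0ℝ + β * det d c b   ≈⟨ pointwise (λ n → ℚₚ.+-identityˡ _) ⟩
    β * det d c b        ∎
    where
    open +-*-Solver
    p∈cd : α * - det c d a + β * det d c b ≈ 0ℝ
    p∈cd = begin
      α * - det c d a + β * det d c b  ≈⟨ +-cong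
        (*-congˡ (≈-trans (det-swap c d a) (≈-sym (det-cyclic a d c))))
        (*-congˡ (≈-sym (det-cyclic b d c))) ⟩
      α * det a d c + β * det b d c    ≈⟨ det-linear p≈αa+βb d c ⟨
      det p d c                        ≈⟨ det-linear p≈γc+δd d c ⟩
      γ * det c d c + δ * det d d c    ≈⟨ +-cong (*-congˡ (det-xyx c d)) (*-congˡ (det-xxy d c)) ⟩
      γ * 0ℝ + δ * 0ℝ                  ≈⟨ pointwise (λ n → solve 2 (λ γ δ →
                                            γ :* con 0ℚ :+ δ :* con 0ℚ := con 0ℚ) refl (seq γ n) (seq δ n)) ⟩
      0ℝ                               ∎

  -- Both sides are `det p d a`, expanded along `c` and `d` on the left and along `a` and `b` on the
  -- right.
  γ∝β : γ * det c d a ≈ β * det a b d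
  γ∝β = begin
    γ * det c d a                    ≈⟨ pointwise (λ n → solve 3 (λ γ δ x →
                                          γ :* x := γ :* x :+ δ :* con 0ℚ) refl
                                          (seq γ n) (seq δ n) (seq (det c d a) n)) ⟩
    γ * det c d a + δ * 0ℝ           ≈⟨ +-cong ≈-refl (*-congˡ (det-xxy d a)) ⟨
    γ * det c d a + δ * det d d a    ≈⟨ det-linear p≈γc+δd d a ⟨
    det p d a                        ≈⟨ det-linear p≈αa+βb d a ⟩
    α * det a d a + β * det b d a    ≈⟨ +-cong (*-congˡ (det-xyx a d))
                                                 (*-congˡ (≈-sym (det-cyclic a b d))) ⟩
    α * 0ℝ + β * det a b d           ≈⟨ pointwise (λ n → solve 2 (λ α r → α :* con 0ℚ :+ r := r) refl
                                          (seq α n) (seq (β * det a b d) n)) ⟩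
    β * det a b d                    ∎
    where open +-*-Solver

proportional-neg : ∀ {α β x y x⁻ y⁻} → - x ≈ x⁻ → - y ≈ y⁻ → α * x ≈ β * y → α * x⁻ ≈ β * y⁻
proportional-neg {α} {β} {x} {y} {x⁻} {y⁻} x⁻≈ y⁻≈ αx≈βy = begin
  α * x⁻     ≈⟨ *-congˡ x⁻≈ ⟨
  α * - x    ≈⟨ pull α x ⟩
  - (α * x)  ≈⟨ -‿cong αx≈βy ⟩
  - (β * y)  ≈⟨ pull β y ⟨
  β * - y    ≈⟨ *-congˡ y⁻≈ ⟩
  β * y⁻     ∎
  where
  open ≈-Reasoning
  open +-*-Solver
  pull : ∀ α x → α * - x ≈ - (α * x)
  pull α x = pointwise λ n → solve 2 (λ α x → α :* :- x := :- (α :* x)) refl (seq α n) (seq x n)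

module Orientation {G : Graph} (T : GreatCircleThrackle G) where
  open GreatCircleThrackle T

  private
    V = Vertex G
    D : V → V → V → ℝ
    D a b c = det (vec (pos a)) (vec (pos b)) (vec (pos c))

    D-swap : ∀ a b c → - D a b c ≈ D b a c
    D-swap a b c = det-swap (vec (pos a)) (vec (pos b)) (vec (pos c))

    D-cyclic : ∀ a b c → D a b c ≈ D b c a
    D-cyclic a b c = det-cyclic (vec (pos a)) (vec (pos b)) (vec (pos c))

    D-GP : ∀ x a b c d → D x a b * D x c d + D x b c * D x a d + D x c a * D x b d ≈ 0ℝ
    D-GP x a b c d =
      grassmann-plücker (vec (pos x)) (vec (pos a)) (vec (pos b)) (vec (pos c)) (vec (pos d))

  -- Otherwise the great circle with normal `b × c` would pass through all three points; this normal
  -- is nonzero because the two points are neither equal nor antipodal.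
  D≉0 : ∀ {a b c} → a ≢ b → b ≢ c → a ≢ c → ¬ D a b c ≈ 0ℝ
  D≉0 {a} {b} {c} a≢b b≢c a≢c D≈0 = noncocircular b≢c (a≢c ∘ sym) (a≢b ∘ sym)
    (record { normal  = vec (pos b) ⨯ vec (pos c)
            ; nonzero = ⨯≉0 (pos b) (pos c) (distinct b≢c) (nonantipodal b≢c) }
    , ≈-trans (on b) (det-xxy (vec (pos b)) (vec (pos c)))
    , ≈-trans (on c) (det-xyx (vec (pos c)) (vec (pos b)))
    , ≈-trans (on a) D≈0)
    where
    on : ∀ x → (vec (pos b) ⨯ vec (pos c)) ∙ vec (pos x) ≈ D x b c
    on x = ∙-comm (vec (pos b) ⨯ vec (pos c)) (vec (pos x))

  module _ (ccw? : ∀ a b c → Dec (0ℝ < D a b c)) where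

    signed : ∀ {a b c} → a ≢ b → b ≢ c → a ≢ c → Signed (D a b c)
    signed {a} {b} {c} a≢b b≢c a≢c with ccw? a b c | ccw? b a c
    ... | yes abc | _       = inj₁ abc
    ... | no _    | yes bac = inj₂ (0<-resp-≈ (≈-sym (D-swap a b c)) bac)
    ... | no ¬abc | no ¬bac = contradiction
      (≮0∧≯0⇒≈0 ¬abc (¬bac ∘ 0<-resp-≈ (D-swap a b c))) (D≉0 a≢b b≢c a≢c)

    module Crossing {a b c d} (a≢b : a ≢ b) (c≢d : c ≢ d)
             (a≢c : a ≢ c) (a≢d : a ≢ d) (b≢c : b ≢ c) (b≢d : b ≢ d)
             {k l α β γ δ} (p : S²)
             (p≈αa+βb : vec p ≈³ α *³ vec (pos a) +³ β *³ vec (pos b))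
             (p≈γc+δd : vec p ≈³ γ *³ vec (pos c) +³ δ *³ vec (pos d))
             (onab : Coefficients k α β) (oncd : Coefficients l γ δ)
             (unique : ∀ q → OnArc k (pos a) (pos b) q → OnArc l (pos c) (pos d) q → q ≈ˢ p)
             where

      negated : ∀ {α β a b} → vec p ≈³ α *³ a +³ β *³ b → -³ vec p ≈³ (- α) *³ a +³ (- β) *³ b
      negated {α} {β} {a} {b} p≈ i = ≈-trans (-‿cong (p≈ i)) (pointwise λ n →
        solve 4 (λ α β x y → :- (α :* x :+ β :* y) := :- α :* x :+ :- β :* y) refl
          (seq α n) (seq β n) (seq (a i) n) (seq (b i) n))
        where open +-*-Solver

      private
        α∝β = Coordinates.α∝β p≈αa+βb p≈γc+δd
        γ∝β = Coordinates.γ∝β p≈αa+βb p≈γc+δd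
        -- The first proportion again, with the pairs exchanged and `c`, `d` taken in the order `d`,
        -- `c`.
        δ∝γ = Coordinates.α∝β (λ i → ≈-trans (p≈γc+δd i) (+-comm _ _)) p≈αa+βb

      -- The last hypothesis makes `p` a positive multiple of `(a × b) × (c × d)`, computed in the
      -- orientation `E`. The proportions carry this sign over to `α`, `γ` and `δ`, so membership of
      -- `p` in the arcs becomes `Meet`. A `Meet` in the reversed orientation would put the antipode
      -- of `p` on both arcs, against uniqueness.
      aligned : ∀ {E : V → V → V → ℝ} →
        (∀ a b c → - E a b c ≈ E b a c) →
        (∀ {a b c} → a ≢ b → b ≢ c → a ≢ c → Signed (E a b c)) →
        α * E c d a ≈ β * E d c b → γ * E c d a ≈ β * E a b d → δ * E a b d ≈ γ * E b a c →
        0ℝ < β * E c d a →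
        Meet (λ x y z → 0ℝ < E x y z) k l a b c d × ¬ Meet (λ x y z → 0ℝ < E y x z) k l a b c d
      aligned {E} E-swap E-signed α∝β γ∝β δ∝γ 0<β[cda] =
        ( coefficients⇒hits 0<α[dcb] 0<β[cda] k [dcb] [cda] onab
        , coefficients⇒hits 0<γ[abd] 0<δ[bac] l [abd] [bac] oncd ) ,
        λ (hits , hits′) → antipode≉ p (unique (antipode p)
          (onArc⁻¹ k (- α , - β , negated p≈αa+βb ,
            hits⇒-coefficients 0<α[dcb] 0<β[cda] k (E-swap d c b) (E-swap c d a) hits))
          (onArc⁻¹ l (- γ , - δ , negated p≈γc+δd ,
            hits⇒-coefficients 0<γ[abd] 0<δ[bac] l (E-swap a b d) (E-swap b a c) hits′)))
        where
        [dcb] = E-signed (c≢d ∘ sym) (b≢c ∘ sym) (b≢d ∘ sym)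
        [cda] = E-signed c≢d (a≢d ∘ sym) (a≢c ∘ sym)
        [abd] = E-signed a≢b b≢d a≢d
        [bac] = E-signed (a≢b ∘ sym) a≢c b≢c
        0<α[dcb] = 0<-proportional α∝β 0<β[cda] [dcb] [cda]
        0<γ[abd] = 0<-proportional γ∝β 0<β[cda] [abd] [cda]
        0<δ[bac] = 0<-proportional δ∝γ 0<γ[abd] [bac] [abd]

      -- Since the determinant is nonzero, `β` would vanish, then `α` by proportionality, and the
      -- unit vector `p` would be zero.
      β[cda]≉0 : ¬ β * D c d a ≈ 0ℝ
      β[cda]≉0 β[cda]≈0 = vec≉0 p λ i → begin
        vec p i                                      ≈⟨ p≈αa+βb i ⟩
        α * vec (pos a) i + β * vec (pos b) i        ≈⟨ +-cong (*-congʳ α≈0) (*-congʳ β≈0) ⟩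
        0ℝ * vec (pos a) i + 0ℝ * vec (pos b) i      ≈⟨ pointwise (λ n →
            solve 2 (λ x y → con 0ℚ :* x :+ con 0ℚ :* y := con 0ℚ) refl
              (seq (vec (pos a) i) n) (seq (vec (pos b) i) n)) ⟩
        0ℝ                                           ∎
        where
        open ≈-Reasoning
        open +-*-Solver
        [cda]≉0 : ¬ D c d a ≈ 0ℝ
        [cda]≉0 = D≉0 c≢d (a≢d ∘ sym) (a≢c ∘ sym)
        β≈0 : β ≈ 0ℝ
        β≈0 = zero-product [cda]≉0 (≈-trans (*-comm (D c d a) β) β[cda]≈0)
        α≈0 : α ≈ 0ℝ
        α≈0 = zero-product [cda]≉0 (begin
          D c d a * α   ≈⟨ *-comm (D c d a) α ⟩
          α * D c d a   ≈⟨ α∝β ⟩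
          β * D d c b   ≈⟨ *-congʳ β≈0 ⟩
          0ℝ * D d c b  ≈⟨ pointwise (λ n → ℚₚ.*-zeroˡ (seq (D d c b) n)) ⟩
          0ℝ            ∎)

      signed⇒crosses : Signed (β * D c d a) → Crosses (λ x y z → 0ℝ < D x y z) k l a b c d
      signed⇒crosses (inj₁ 0<β[cda]) = inj₁ (aligned {D} D-swap signed α∝β γ∝β δ∝γ 0<β[cda])
      -- Here `p` is a positive multiple of the opposite vector, which is the one belonging to the
      -- reversed orientation `flip D`.
      signed⇒crosses (inj₂ 0<-β[cda]) = inj₂ (aligned {flip D} (λ x y z → D-swap y x z)
        (λ x≢y y≢z x≢z → signed (x≢y ∘ sym) x≢z y≢z)
        (proportional-neg (D-swap c d a) (D-swap d c b) α∝β)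
        (proportional-neg (D-swap c d a) (D-swap a b d) γ∝β)
        (proportional-neg (D-swap a b d) (D-swap b a c) δ∝γ)
        (0<-resp-≈ (≈-trans (neg-right β (D c d a)) (*-congˡ (D-swap c d a))) 0<-β[cda]))
        where
        neg-right : ∀ x y → - (x * y) ≈ x * - y
        neg-right x y = pointwise λ n → ℚₚ.neg-distribʳ-* (seq x n) (seq y n)

    adj⇒≢ : ∀ {a b} → Adj G a b → a ≢ b
    adj⇒≢ ab refl = irrefl-Adj G ab

    crossing : ∀ {a b c d} → Adj G a b → Adj G c d → a ≢ c → a ≢ d → b ≢ c → b ≢ d →
               Crosses (λ x y z → 0ℝ < D x y z) (kind a b) (kind c d) a b c d
    crossing {a} {b} {c} {d} ab cd a≢c a≢d b≢c b≢d =
      let p , (onab , oncd) , unique = thrackle ab cd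
            λ { (inj₁ (a≡c , _)) → a≢c a≡c ; (inj₂ (a≡d , _)) → a≢d a≡d }
          α , β , p≈αa+βb , coeff = onArc (kind a b) onab
          γ , δ , p≈γc+δd , coeff′ = onArc (kind c d) oncd
          open Crossing (adj⇒≢ ab) (adj⇒≢ cd) a≢c a≢d b≢c b≢d p p≈αa+βb p≈γc+δd coeff coeff′ unique
      -- The sign of `β * D c d a` is known only up to double negation, which suffices because
      -- `Crosses` is decidable.
      in decidable-stable (crosses? ccw? (kind a b) (kind c d) a b c d)
           (¬¬-map signed⇒crosses (¬¬-signed β[cda]≉0))

    long-isolated : ∀ {a b c} → Adj G a b → Adj G a c → b ≢ c → kind a b ≡ long → kind a c ≢ long
    long-isolated {a} {b} {c} ab ac b≢c ab-long ac-long =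
      let p , _ , unique = thrackle ab ac
            λ { (inj₁ (_ , b≡c)) → b≢c b≡c ; (inj₂ (a≡c , _)) → adj⇒≢ ac a≡c }
          a≈p  = unique (pos a) (start-on b ab-long) (start-on c ac-long)
          -a≈p = unique (antipode (pos a)) (antipode-on b ab-long) (antipode-on c ac-long)
      in antipode≉ (pos a) λ i → ≈-trans (-a≈p i) (≈-sym (a≈p i))
      where
      open +-*-Solver
      -- With coefficient zero at the other endpoint, both signs of the coefficient at `a` satisfy
      -- the condition for a long arc.
      start-on : ∀ v {k} → k ≡ long → OnArc k (pos a) (pos v) (pos a)
      start-on v refl = 1ℝ , 0ℝ , (λ i → pointwise λ n →
        solve 2 (λ x y → x := con 1ℚ :* x :+ con 0ℚ :* y) refl
          (seq (vec (pos a) i) n) (seq (vec (pos v) i) n)) , 0≮0 ∘ proj₂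
      antipode-on : ∀ v {k} → k ≡ long → OnArc k (pos a) (pos v) (antipode (pos a))
      antipode-on v refl = - 1ℝ , 0ℝ , (λ i → pointwise λ n →
        solve 2 (λ x y → :- x := con (ℚ.- 1ℚ) :* x :+ con 0ℚ :* y) refl
          (seq (vec (pos a) i) n) (seq (vec (pos v) i) n)) , 0≮0 ∘ proj₂

    orientedThrackle : OrientedThrackle G
    orientedThrackle = record
      { Ccw  = λ a b c → 0ℝ < D a b c
      ; ccw? = ccw?
      ; cyclic = λ {a} {b} {c} → 0<-resp-≈ (D-cyclic a b c)
      ; asym   = λ {a} {b} {c} abc bac → 0<-asym abc (0<-resp-≈ (≈-sym (D-swap a b c)) bac)
      ; connex = λ {a} {b} {c} a≢b b≢c a≢c ¬abc →
          [ (λ abc → contradiction abc ¬abc) , 0<-resp-≈ (D-swap a b c) ]′ (signed a≢b b≢c a≢c)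
      -- The six signs make all three products of the Grassmann-Plücker relation positive, yet they
      -- sum to zero. Reversing the orientation changes both factors of each product.
      ; unsurrounded = λ {x} {a} {b} {c} {d} xab xbc xca xad xbd xcd →
          0≮0 (0<-resp-≈ (D-GP x a b c d) (0<+ (0<+ (0<* xab xcd) (0<* xbc xad)) (0<* xca xbd)))
      ; unsurrounded⁻ = λ {x} {a} {b} {c} {d} axb bxc cxa axd bxd cxd →
          0≮0 (0<-resp-≈
            (≈-trans (+-cong (+-cong (reverse x a b c d) (reverse x b c a d)) (reverse x c a b d))
                     (D-GP x a b c d))
            (0<+ (0<+ (0<* axb cxd) (0<* bxc axd)) (0<* cxa bxd)))
      ; kind = kind
      ; kind-sym = kind-sym
      ; long-isolated = long-isolated
      ; crossing = crossing
      }
      where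
      reverse : ∀ x a b c d → D a x b * D c x d ≈ D x a b * D x c d
      reverse x a b c d = ≈-trans
        (≈-sym (*-cong (D-swap x a b) (D-swap x c d))) (-x*-y≈x*y (D x a b) (D x c d))

  -- There are finitely many triples of vertices, so all their signs can be decided together under a
  -- double negation, which is harmless when a contradiction is sought.
  orient : ¬ ¬ OrientedThrackle G
  orient = ¬¬-map orientedThrackle
    (¬¬-∀ G λ a → ¬¬-∀ G λ b → ¬¬-∀ G λ c → ¬¬-excluded-middle)

-- Excluded configurations

module Obstructions {G} (T : OrientedThrackle G) where
  open OrientedThrackle T

  private
    variable
      a b c p q t u v w x y z : Vertex G

  cyclic² : Ccw a b c → Ccw c a b
  cyclic² abc = cyclic (cyclic abc)

  -- A short arc from a stays on one side of the great circle through z and a.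
  short-separated : Ccw z a p → Ccw z q a →
    Crosses Ccw short short a b z p → ¬ Crosses Ccw short short a b z q
  short-separated zap zqa (inj₁ (((_ , zpa) , _) , _)) _ = asym zpa (cyclic² zap)
  short-separated zap zqa (inj₂ ((_ , (_ , abz)) , _)) (inj₁ ((_ , (_ , baz)) , _)) = asym abz baz
  short-separated zap zqa (inj₂ _) (inj₂ (((_ , qza) , _) , _)) = asym zqa qza

  -- The sign `abz` decides at which of two antipodal points `bc` crosses `za`, and hence the side
  -- of `bc` on which `z` lies. This forces the crossing of `bc` with `zp` to give `Ccw z p b`. Then
  -- the short arc complementary to `ab` crosses `zp`, so the long one misses it.
  long-then-short : Ccw z a p → Ccw a b z →
    Crosses Ccw long short a b z p → Crosses Ccw short short b c z a →
    ¬ Crosses Ccw short short b c z p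
  long-then-short zap abz ab⋈zp (inj₂ (((_ , azb) , _) , _)) _ = asym (cyclic² abz) azb
  long-then-short zap abz ab⋈zp (inj₁ ((_ , (_ , cbz)) , _)) (inj₂ ((_ , (_ , bcz)) , _)) = asym cbz bcz
  long-then-short zap abz (inj₁ ((_ , (_ , baz)) , _)) (inj₁ _) (inj₁ _) = asym abz baz
  long-then-short zap abz (inj₂ ((miss , _) , _)) (inj₁ _) (inj₁ (((_ , zpb) , _) , _)) =
    miss (zpb , cyclic² zap)

  -- Three of the four signs that hold when the short arcs `ut` and `zv` meet in
  -- `(u × t) × (z × v)`.
  record SameSide (z u t v : Vertex G) : Set where
    field
      zvu : Ccw z v u
      utv : Ccw u t v
      tuz : Ccw t u z

  same-side : Ccw u z v → Crosses Ccw short short u t z v → SameSide z u t v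
  same-side uzv (inj₁ (((_ , zvu) , (utv , tuz)) , _)) = record { zvu = zvu ; utv = utv ; tuz = tuz }
  same-side uzv (inj₂ (((_ , vzu) , _) , _)) = contradiction vzu (asym (cyclic uzv))

  -- The sign `tuz` does not mention `v`, so it also picks the point at which `ut` crosses `zw`.
  same-side-transfer : SameSide z u t v → Crosses Ccw short short u t z w → SameSide z u t w
  same-side-transfer v-side (inj₁ (((_ , zwu) , (utw , tuz)) , _)) =
    record { zvu = zwu ; utv = utw ; tuz = tuz }
  same-side-transfer v-side (inj₂ ((_ , (_ , utz)) , _)) =
    contradiction utz (asym (SameSide.tuz v-side))

  -- Crossing `zv` forces `wxz` and crossing `ut` forces `xwu`, so the circle through `wx` separates
  -- `z` from `u`. The point where `wx` must meet `zu` then lies on the short arc from `z` to `u`,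
  -- and the long one misses it.
  short-beside-long : SameSide z u t w → Ccw z w v →
    Crosses Ccw short short w x z v → Crosses Ccw short long w x z u →
    ¬ Crosses Ccw short short w x u t
  short-beside-long w-side zwv (inj₁ (((_ , zvw) , _) , _)) _ _ = asym zvw (cyclic² zwv)
  short-beside-long w-side zwv (inj₂ _) (inj₁ (((_ , zuw) , _) , _)) _ =
    asym zuw (cyclic² (SameSide.zvu w-side))
  short-beside-long w-side zwv
    (inj₂ ((_ , (_ , wxz)) , _)) (inj₂ ((_ , miss) , _)) (inj₁ ((_ , (_ , xwu)) , _)) =
    miss (xwu , wxz)
  short-beside-long w-side zwv (inj₂ _) (inj₂ _) (inj₂ (((_ , tuw) , _) , _)) =
    asym tuw (SameSide.utv w-side)

  -- The crossings with `zv` and `zw` fix the signs `xwz`, `yxw` and `xyz`. The crossing of `wx`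
  -- with `zu` then leaves only `zux` with `xwu`, or `uzx` with `wxu`.
  long-beside-long : SameSide z u t w → Ccw z w v →
    w ≢ u → w ≢ x → x ≢ u → x ≢ y → y ≢ u → z ≢ u → z ≢ x → t ≢ u → t ≢ x →
    Crosses Ccw long short w x z v → Crosses Ccw long long w x z u →
    Crosses Ccw long short w x u t →
    Crosses Ccw short short x y z w → Crosses Ccw short short x y z v →
    ¬ Crosses Ccw short long x y z u
  long-beside-long {z} {u} {t} {w} {v} {x} {y} w-side zwv
    w≢u w≢x x≢u x≢y y≢u z≢u z≢x t≢u t≢x wx⋈zv wx⋈zu wx⋈ut xy⋈zw xy⋈zv xy⋈zu =
    impossible wx⋈zu
    where
    open SameSide w-side renaming (zvu to zwu; utv to utw)

    -- This is the argument of `long-then-short` with `w`, `x`, `y`, `v` in the roles of `a`, `b`,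
    -- `c`, `p`.
    ¬wxz : ¬ Ccw w x z
    ¬wxz wxz = case wx⋈zv , xy⋈zw , xy⋈zv of λ where
      (inj₁ ((_ , (_ , xwz)) , _) , _ , _) → asym wxz xwz
      (inj₂ _ , inj₂ (((_ , wzx) , _) , _) , _) → asym wxz (cyclic² wzx)
      (inj₂ _ , inj₁ ((_ , (_ , yxz)) , _) , inj₂ ((_ , (_ , xyz)) , _)) → asym yxz xyz
      (inj₂ ((miss , _) , _) , inj₁ _ , inj₁ (((_ , zvx) , _) , _)) → miss (zvx , cyclic² zwv)

    xwz : Ccw x w z
    xwz = case wx⋈zv of λ where
      (inj₁ ((_ , (_ , xwz)) , _)) → xwz
      (inj₂ ((_ , (_ , wxz)) , _)) → contradiction wxz ¬wxz

    yxw,xyz : Ccw y x w × Ccw x y z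
    yxw,xyz = case xy⋈zw of λ where
      (inj₁ (((_ , zwx) , _) , _)) → contradiction (cyclic zwx) ¬wxz
      (inj₂ ((_ , yxw,xyz) , _))   → yxw,xyz

    uzw : Ccw u z w
    uzw = cyclic² zwu

    ¬zuw : ¬ Ccw z u w
    ¬zuw zuw = asym zuw uzw

    -- The crossing with `ut` yields `utx`; seen from `u`, the vertices `z`, `t`, `x` wind around,
    -- while `w` has all three on one side.
    x-opposite : Ccw z u x → ¬ Ccw x w u
    x-opposite zux xwu = case wx⋈ut of λ where
      (inj₂ ((_ , (_ , wxu)) , _)) → asym wxu xwu
      (inj₁ ((miss , _) , _)) →
        let utx = connex t≢u (x≢u ∘ sym) t≢x λ tux → miss (tux , utw)
        in unsurrounded (cyclic tuz) utx (cyclic zux) uzw utw (cyclic² xwu)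

    -- The crossing of `xy` with `zu` yields `xyu`; seen from `x`, the vertices `w`, `y`, `u` wind
    -- around, while `z` has all three on one side.
    x-beside : Ccw u z x → ¬ Ccw w x u
    x-beside uzx wxu = case xy⋈zu of λ where
      (inj₁ (((_ , zux) , _) , _)) → asym zux uzx
      (inj₂ ((_ , miss) , _)) →
        let xyu = connex (x≢y ∘ sym) x≢u y≢u λ yxu → miss (yxu , proj₂ yxw,xyz)
        in unsurrounded (cyclic (proj₁ yxw,xyz)) xyu (cyclic wxu) xwz (proj₂ yxw,xyz) (cyclic² uzx)

    -- In each case `miss` and the signs already known let the excluded configurations show that the
    -- antipode lies on both long arcs as well, which `once` denies.
    impossible : ¬ Crosses Ccw long long w x z u
    impossible (inj₁ ((_ , miss) , once)) = once
      ( (λ (zux , _) → x-opposite zux (connex w≢x x≢u w≢u λ wxu → miss (wxu , xwz)))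
      , ¬wxz ∘ proj₂ )
    impossible (inj₂ ((miss , _) , once)) = once
      ( ¬zuw ∘ proj₂
      , λ (wxu , _) → x-beside (connex z≢u (x≢u ∘ sym) z≢x λ zux → miss (zux , uzw)) wxu )

-- Edges and crossings of the spider

¬long⇒short : ∀ {k} → k ≢ long → k ≡ short
¬long⇒short {short} _     = refl
¬long⇒short {long}  ¬long = contradiction refl ¬long

module Legs (T : OrientedThrackle spider₃₃₃) where
  open OrientedThrackle T public

  leg-≢ : ∀ {i j m n} → i ≢ j → leg i m ≢ leg j n
  leg-≢ i≢j refl = i≢j refl

  -- Replacing the kinds by known constructors lets `Hits` compute, as the obstructions above
  -- require.
  crossing-of-kinds : ∀ {a b c d k l} → kind a b ≡ k → kind c d ≡ l →
    Crosses Ccw (kind a b) (kind c d) a b c d → Crosses Ccw k l a b c d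
  crossing-of-kinds refl refl ab⋈cd = ab⋈cd

  step⋈root : ∀ {i j} m {k l} → i ≢ j →
    kind (leg i (inject₁ m)) (leg i (suc m)) ≡ k → kind centre (leg j 0F) ≡ l →
    Crosses Ccw k l (leg i (inject₁ m)) (leg i (suc m)) centre (leg j 0F)
  step⋈root {i} {j} m i≢j k≡ l≡ = crossing-of-kinds k≡ l≡
    (crossing (fwd (step i m)) (fwd (root j)) (λ ()) (leg-≢ i≢j) (λ ()) (leg-≢ i≢j))

  step₁⋈root : ∀ {i k l} → kind (leg i 1F) (leg i 2F) ≡ k → kind centre (leg i 0F) ≡ l →
    Crosses Ccw k l (leg i 1F) (leg i 2F) centre (leg i 0F)
  step₁⋈root {i} k≡ l≡ = crossing-of-kinds k≡ l≡
    (crossing (fwd (step i 1F)) (fwd (root i)) (λ ()) (λ ()) (λ ()) (λ ()))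

  step₀⋈step₀ : ∀ {i j k l} → i ≢ j →
    kind (leg i 0F) (leg i 1F) ≡ k → kind (leg j 0F) (leg j 1F) ≡ l →
    Crosses Ccw k l (leg i 0F) (leg i 1F) (leg j 0F) (leg j 1F)
  step₀⋈step₀ {i} {j} i≢j k≡ l≡ = crossing-of-kinds k≡ l≡
    (crossing (fwd (step i 0F)) (fwd (step j 0F)) (leg-≢ i≢j) (leg-≢ i≢j) (leg-≢ i≢j) (leg-≢ i≢j))

  long-root⇒short-root : ∀ {i j} → i ≢ j →
    kind centre (leg i 0F) ≡ long → kind centre (leg j 0F) ≡ short
  long-root⇒short-root {i} {j} i≢j i-long =
    ¬long⇒short (long-isolated (fwd (root i)) (fwd (root j)) (leg-≢ i≢j) i-long)

  long-root⇒short-step : ∀ {i} → kind centre (leg i 0F) ≡ long → kind (leg i 0F) (leg i 1F) ≡ short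
  long-root⇒short-step {i} i-long = ¬long⇒short
    (long-isolated (bwd (root i)) (fwd (step i 0F)) (λ ())
      (trans (kind-sym (leg i 0F) centre) i-long))

  long-step⇒short-step : ∀ {i} →
    kind (leg i 0F) (leg i 1F) ≡ long → kind (leg i 1F) (leg i 2F) ≡ short
  long-step⇒short-step {i} i-long = ¬long⇒short
    (long-isolated (bwd (step i 0F)) (fwd (step i 1F)) (λ ())
      (trans (kind-sym (leg i 1F) (leg i 0F)) i-long))

  ccw-legs : ∀ i j → i ≢ j →
    Ccw centre (leg i 0F) (leg j 0F) ⊎ Ccw centre (leg j 0F) (leg i 0F)
  ccw-legs i j i≢j with ccw? centre (leg i 0F) (leg j 0F)
  ... | yes zij = inj₁ zij
  ... | no ¬zij = inj₂ (cyclic (connex (λ ()) (leg-≢ i≢j) (λ ()) ¬zij))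

-- All edges at the centre short

module ShortRoots (T : OrientedThrackle spider₃₃₃)
  (short-root : ∀ i → OrientedThrackle.kind T centre (leg i 0F) ≡ short) where

  open Legs T
  open Obstructions T

  middle-leg : ∀ {i j k} → i ≢ j → i ≢ k → Ccw centre (leg i 0F) (leg j 0F) →
           ¬ Ccw centre (leg k 0F) (leg i 0F)
  middle-leg {i} {j} {k} i≢j i≢k zij zki with kind (leg i 0F) (leg i 1F) in eq
  ... | short = short-separated zij zki
    (step⋈root 0F i≢j eq (short-root j)) (step⋈root 0F i≢k eq (short-root k))
  ... | long with ccw? (leg i 0F) (leg i 1F) centre
  ...   | yes abz = long-then-short zij abz (step⋈root 0F i≢j eq (short-root j))
            (step₁⋈root (long-step⇒short-step eq) (short-root i))
            (step⋈root 1F i≢j (long-step⇒short-step eq) (short-root j))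
  -- The other sign is the mirror image, in which leg `k` takes over the role of leg `j`.
  ...   | no ¬abz = Obstructions.long-then-short (mirror T) (cyclic² zki)
            (connex (λ ()) (λ ()) (λ ()) ¬abz)
            (Legs.step⋈root (mirror T) 0F i≢k eq (short-root k))
            (Legs.step₁⋈root (mirror T) (long-step⇒short-step eq) (short-root i))
            (Legs.step⋈root (mirror T) 1F i≢k (long-step⇒short-step eq) (short-root k))

  -- The signs at the centre form a tournament on the three legs, and every such tournament has a
  -- vertex with both an incoming and an outgoing arc.
  impossible : ⊥
  impossible with ccw-legs 0F 1F (λ ()) | ccw-legs 1F 2F (λ ()) | ccw-legs 2F 0F (λ ())
  ... | inj₁ z01 | inj₁ z12 | _        = middle-leg (λ ()) (λ ()) z12 z01
  ... | inj₁ z01 | inj₂ z21 | inj₁ z20 = middle-leg (λ ()) (λ ()) z01 z20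
  ... | inj₁ z01 | inj₂ z21 | inj₂ z02 = middle-leg (λ ()) (λ ()) z21 z02
  ... | inj₂ z10 | inj₁ z12 | inj₁ z20 = middle-leg (λ ()) (λ ()) z20 z12
  ... | inj₂ z10 | inj₁ z12 | inj₂ z02 = middle-leg (λ ()) (λ ()) z02 z10
  ... | inj₂ z10 | inj₂ z21 | _        = middle-leg (λ ()) (λ ()) z10 z21

-- A long edge at the centre

module LongRoot (T : OrientedThrackle spider₃₃₃) {k : Fin 3}
  (k-long : OrientedThrackle.kind T centre (leg k 0F) ≡ long) where

  open Legs T
  open Obstructions T

  SameSideLeg : Fin 3 → Set
  SameSideLeg i = SameSide centre (leg k 0F) (leg k 1F) (leg i 0F)

  short-root : ∀ {i} → i ≢ k → kind centre (leg i 0F) ≡ short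
  short-root i≢k = long-root⇒short-root (i≢k ∘ sym) k-long

  step⋈short-root : ∀ {i} → i ≢ k →
    Crosses Ccw short short (leg k 0F) (leg k 1F) centre (leg i 0F)
  step⋈short-root i≢k =
    step⋈root 0F (i≢k ∘ sym) (long-root⇒short-step k-long) (short-root i≢k)

  -- Leg `j` supplies `w`, `x`, `y`, leg `i` supplies `v`, and the long leg `k` supplies `u`, `t`;
  -- the kind of `wx` selects the obstruction.
  unordered : ∀ {i j} → i ≢ j → i ≢ k → j ≢ k → SameSideLeg j → ¬ Ccw centre (leg j 0F) (leg i 0F)
  unordered {i} {j} i≢j i≢k j≢k j-side zji with kind (leg j 0F) (leg j 1F) in eq
  ... | short = short-beside-long j-side zji
    (step⋈root 0F (i≢j ∘ sym) eq (short-root i≢k))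
    (step⋈root 0F j≢k eq k-long)
    (step₀⋈step₀ j≢k eq (long-root⇒short-step k-long))
  ... | long = long-beside-long j-side zji
    (leg-≢ j≢k) (λ ()) (leg-≢ j≢k) (λ ()) (leg-≢ j≢k) (λ ()) (λ ()) (λ ()) (leg-≢ (j≢k ∘ sym))
    (step⋈root 0F (i≢j ∘ sym) eq (short-root i≢k))
    (step⋈root 0F j≢k eq k-long)
    (step₀⋈step₀ j≢k eq (long-root⇒short-step k-long))
    (step₁⋈root (long-step⇒short-step eq) (short-root j≢k))
    (step⋈root 1F (i≢j ∘ sym) (long-step⇒short-step eq) (short-root i≢k))
    (step⋈root 1F j≢k (long-step⇒short-step eq) k-long)

  -- Both other legs lie on the same side of the long edge, so either of their two orders around the
  -- centre is excluded by `unordered`.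
  ¬ccw : ∀ {i j} → i ≢ j → i ≢ k → j ≢ k → ¬ Ccw (leg k 0F) centre (leg i 0F)
  ¬ccw {i} {j} i≢j i≢k j≢k uzi =
    [ unordered (i≢j ∘ sym) j≢k i≢k i-side , unordered i≢j i≢k j≢k j-side ]′ (ccw-legs i j i≢j)
    where
    i-side : SameSideLeg i
    i-side = same-side uzi (step⋈short-root i≢k)
    j-side : SameSideLeg j
    j-side = same-side-transfer i-side (step⋈short-root j≢k)

no-long-root : ∀ (T : OrientedThrackle spider₃₃₃) {i j k} → i ≢ j → i ≢ k → j ≢ k →
               OrientedThrackle.kind T centre (leg k 0F) ≢ long
no-long-root T {i} {j} {k} i≢j i≢k j≢k k-long = LongRoot.¬ccw T k-long i≢j i≢k j≢k
  -- Leg `i` lies on one of the two sides of the long edge; the reflected drawing excludes the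
  -- second side.
  (connex (λ ()) (leg-≢ i≢k ∘ sym) (λ ())
    (LongRoot.¬ccw (mirror T) k-long i≢j i≢k j≢k))
  where open Legs T

¬orientedSpider : ¬ OrientedThrackle spider₃₃₃
¬orientedSpider T = ShortRoots.impossible T λ where
  0F → ¬long⇒short (no-long-root T {1F} {2F} (λ ()) (λ ()) (λ ()))
  1F → ¬long⇒short (no-long-root T {0F} {2F} (λ ()) (λ ()) (λ ()))
  2F → ¬long⇒short (no-long-root T {0F} {1F} (λ ()) (λ ()) (λ ()))

corollary3p3 : (G : Graph) → G Contains spider₃₃₃ → ¬ GreatCircleThrackle G
corollary3p3 G contains T = Orientation.orient (restrict contains T) ¬orientedSpider
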